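{- Let $R=(b_1,b_2)$ be a reduced basis of a two-dimensional lattice in $\mathbb{R}^2$ with $|b_1|=|b_2|$ and $m=-1/2$, where $m=(b_2,b_1)/(b_1,b_1)$. Let $U\in GL_2(\mathbb{Z})$ and let $\omega_1$ be any decomposition of $U$ in terms of the family of generators $\{S,T\}$ (a word on $\{S,T,T^{ -1}\}$ whose value is $U$). Then the Gaussian decomposition of $U$ (relative to $R$) is obtained from $\omega_1$ by applying repeatedly the following set of rules: (R1) $S^2\longrightarrow 1$; (R2) $T^xT^y\longrightarrow T^{x+y}$; (R3) for all integers $x<0$: $ST^{2}ST^{x}\longrightarrow TST^{ -2}ST^{x+1}$; (R4) for all integers $x>0$: $ST^{ -2}ST^{x}\longrightarrow T^{ -1}ST^{2}ST^{x-1}$; (R5') for all $x\in\mathbb{Z}\setminus\{0\}$ and all integers $k\ge 0$: $ST\,ST^{x}\bigl(\prod_{i=k}^{1}ST^{y_i}\bigr)\longrightarrow T\,ST^{ -x-1}\bigl(\prod_{i=k}^{1}ST^{ -y_i}\bigr)T$; (R6') for all $x\in\mathbb{Z}\setminus\{0\}$ and all integers $k\ge 0$: $ST^{ -1}ST^{x}\bigl(\prod_{i=k}^{1}ST^{y_i}\bigr)\longrightarrow T^{ -1}ST^{ -x+1}\bigl(\prod_{i=k}^{1}ST^{ -y_i}\bigr)T$; (R10) if the word is $\omega S$, then $\omega S\longrightarrow\omega$; (R11) if the word is $\omega ST$, then $\omega ST\longrightarrow\omega T$; (R12) if the word is $\omega ST^2$, then $\omega ST^2\longrightarrow\omega TST^{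 -1}$.
   Context: Bases: a basis $(b_1,b_2)$ of a two-dimensional lattice in $\mathbb{R}^2$ is identified with the $2\times2$ real matrix whose rows are $b_1,b_2$. $(\cdot,\cdot)$ is the usual scalar product and $|\cdot|$ the Euclidean norm. Put $m=(b_2,b_1)/(b_1,b_1)$. The basis is proper if $-1/2\le m<1/2$, and reduced (Gauss-reduced) if it is proper and $|b_1|\le|b_2|$. Matrices: $S=\begin{pmatrix} 0 & 1 \\ 1 & 0 \end{pmatrix}$, $T=\begin{pmatrix} 1 & 0 \\ 1 & 1 \end{pmatrix}$, so $T^x=\begin{pmatrix} 1 & 0 \\ x & 1 \end{pmatrix}$ for $x\in\mathbb{Z}$. The product $\prod_{i=k}^1 ST^{x_i}$ means $ST^{x_k}ST^{x_{k-1}}\cdots ST^{x_1}$ (empty if $k=0$). Gaussian algorithm: on input a basis $B=(b_1,b_2)$, repeat: replace $b_2$ by $b_2-xb_1$, where $x$ is the integer nearest to $m$, chosen so that the new basis is proper (this replaces $B$ by $T^{ -x}B$); then, if $|b_1|>|b_2|$, swap $b_1$ and $b_2$ (this replaces $B$ by $SB$) and iterate; otherwise stop. The output is a reduced basis. If the successive translation integers are $x_{k+1},x_k,\dots,x_1$ (with a swap between consecutive translations), the execution is recorded by the word $T^{x_{k+1}}ST^{x_k}\cdots ST^{x_2}ST^{x_1}$, and the input equals this product times the output. Gaussian decomposition: given a reduced basis $R$ and $U\in GL_2(\mathbb{Z})$, the Gaussian decomposition of $U$ (relative to $R$) is the word recorded by the Gaussian algorithm when run on the input basis $UR$. Words and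 rewriting: the alphabet is $\Sigma=\{S,T,T^{ -1}\}$ and $1$ denotes the empty word. Rules (R1), (R2) are trivial rules, applied whenever possible, so every word can be written $T^{x_{k+1}}\prod_{i=k}^1ST^{x_i}$ with $x_i\ne0$ for $2\le i\le k$ and $x_1,x_{k+1}\in\mathbb{Z}$; the other rules are applied to words in this form, the displayed powers of $T$ being the full exponents. In (R5'), (R6') the displayed product runs to the right end of the word. A word is reduced if no rule can be applied to it. "Obtained by applying repeatedly the rules" means that, starting from $\omega_1$, the rules are applied until a reduced word is reached, which is the asserted word. -}

module Defs where

open import Algebra.Apartness.Bundles using (HeytingCommutativeRing; HeytingField)
open import Algebra.Bundles using (CommutativeRing)
import Algebra.Definitions as AlgebraDefinitions
import Algebra.Definitions.RawMonoid as RawMonoidDefinitions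
open import Data.Integer.Base as ℤ using (ℤ; +_; -[1+_]; 0ℤ; 1ℤ; -1ℤ)
open import Data.List.Base using (List; []; _∷_; _++_; _∷ʳ_; [_]; concatMap; map; replicate)
open import Data.List.Relation.Unary.All using (All)
open import Data.Nat.Base as ℕ using (ℕ; suc)
open import Data.Product using (_×_; _,_; ∃; ∃-syntax; proj₁)
open import Data.Sum.Base using (_⊎_)
open import Function.Base using (flip)
open import Induction.WellFounded using (Acc)
open import Level using (_⊔_) renaming (suc to lsuc)
open import Relation.Binary.Construct.Closure.ReflexiveTransitive using (Star)
open import Relation.Binary.Core using (Rel)
open import Relation.Binary.PropositionalEquality using (_≡_; _≢_)
open import Relation.Binary.Rewriting using (IsNormalForm)
open import Relation.Binary.Structures using (IsStrictPartialOrder)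
open import Relation.Nullary.Negation using (¬_)

------------------------------------------------------------------------
-- The real numbers

-- ℝ, given by its axioms: an Archimedean, Cauchy complete ordered field.
-- The order is not assumed decidable, so that constructive reals are a model
-- as well; classically the axioms determine ℝ up to isomorphism.

record RealField c ℓ₁ ℓ₂ : Set (lsuc (c ⊔ ℓ₁ ⊔ ℓ₂)) where
  field
    heytingField : HeytingField c ℓ₁ ℓ₂

  open HeytingField heytingField public

  commutativeRing : CommutativeRing c ℓ₁
  commutativeRing = HeytingCommutativeRing.commutativeRing heytingCommutativeRing

  open RawMonoidDefinitions (CommutativeRing.+-rawMonoid commutativeRing) public
    using () renaming (_×_ to _×ⁿ_)

  infix 4 _<_ _≤_
  field
    _<_                  : Rel Carrier ℓ₂
    isStrictPartialOrder : IsStrictPartialOrder _≈_ _<_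
    <⇒#                  : ∀ {x y} → x < y → x # y
    #⇒<⊎>                : ∀ {x y} → x # y → x < y ⊎ y < x
    0<1                  : 0# < 1#
    +-monoˡ-<            : ∀ z {x y} → x < y → x + z < y + z
    *-pos                : ∀ {x y} → 0# < x → 0# < y → 0# < x * y

  _≤_ : Rel Carrier ℓ₂
  x ≤ y = ¬ (y < x)

  field
    archimedean : ∀ x → ∃[ n ] x < n ×ⁿ 1#
    complete    : (f : ℕ → Carrier) →
      (∀ ε → 0# < ε → ∃[ N ] (∀ i j → N ℕ.≤ i → N ℕ.≤ j → f i < f j + ε)) →
      ∃[ l ] (∀ ε → 0# < ε →
        ∃[ N ] (∀ i → N ℕ.≤ i → (f i < l + ε) × (l < f i + ε)))

  -- Square roots exist by completeness; naming them here gives the Euclidean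
  -- norm.  Nothing is said about the root of a negative number.
  field
    √        : Carrier → Carrier
    √-cong   : ∀ {x y} → x ≈ y → √ x ≈ √ y
    √-nonneg : ∀ {x} → 0# ≤ x → 0# ≤ √ x
    √-square : ∀ {x} → 0# ≤ x → √ x * √ x ≈ x

  inverse : ∀ {x} → x # 0# → Carrier
  inverse x#0 = proj₁ (#⇒invertible x#0)

  divide : ∀ (x y : Carrier) → y # 0# → Carrier
  divide x y y#0 = x * inverse y#0

  0<1+1 : 0# < 1# + 1#
  0<1+1 = IsStrictPartialOrder.trans isStrictPartialOrder 0<1
    (IsStrictPartialOrder.<-respˡ-≈ isStrictPartialOrder (+-identityˡ 1#)
      (+-monoˡ-< 1# 0<1))

  ½ : Carrier
  ½ = inverse (#-sym (<⇒# 0<1+1))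

  fromℤ : ℤ → Carrier
  fromℤ (+ n)    = n ×ⁿ 1#
  fromℤ -[1+ n ] = - (suc n ×ⁿ 1#)

------------------------------------------------------------------------
-- Integer 2×2 matrices

record Mat₂ : Set where
  constructor mat
  field
    m₁₁ m₁₂ m₂₁ m₂₂ : ℤ

infixl 7 _⊗_

_⊗_ : Mat₂ → Mat₂ → Mat₂
mat a b c d ⊗ mat a′ b′ c′ d′ = mat
  (a ℤ.* a′ ℤ.+ b ℤ.* c′) (a ℤ.* b′ ℤ.+ b ℤ.* d′)
  (c ℤ.* a′ ℤ.+ d ℤ.* c′) (c ℤ.* b′ ℤ.+ d ℤ.* d′)

I₂ : Mat₂
I₂ = mat 1ℤ 0ℤ
         0ℤ 1ℤ

IsGL₂ : Mat₂ → Set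
IsGL₂ = AlgebraDefinitions.Invertible _≡_ I₂ _⊗_

------------------------------------------------------------------------
-- Words

data Letter : Set where
  S T T⁻¹ : Letter

Word : Set
Word = List Letter

letterValue : Letter → Mat₂
letterValue S   = mat 0ℤ  1ℤ
                      1ℤ  0ℤ
letterValue T   = mat 1ℤ  0ℤ
                      1ℤ  1ℤ
letterValue T⁻¹ = mat 1ℤ  0ℤ
                      -1ℤ 1ℤ

value : Word → Mat₂
value []      = I₂
value (l ∷ w) = letterValue l ⊗ value w

T^ : ℤ → Word
T^ (+ n)    = replicate n T
T^ -[1+ n ] = replicate (suc n) T⁻¹

-- The list is read from left to right: ∏ [ x_k , … , x₁ ] is the word
-- S T^x_k ⋯ S T^x₁.

∏ : List ℤ → Word
∏ = concatMap (λ x → S ∷ T^ x)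

-- The words to which R1 and R2 no longer apply; xs lists x_k , … , x₂.

data TriviallyReduced : Word → Set where
  power   : ∀ x → TriviallyReduced (T^ x)
  product : ∀ x {xs} x₁ → All (_≢ 0ℤ) xs → TriviallyReduced (T^ x ++ ∏ (xs ∷ʳ x₁))

------------------------------------------------------------------------
-- The rewriting rules

-- In R3–R6′ the part of the word right of T^x is a product ∏ ys, which is how
-- T^x is made to carry its full exponent.  In R2 the side condition discards
-- the instances that leave the word unchanged (x and y of the same sign, or
-- one of them zero); with them no word would ever be reduced.

infix 4 _⟶_ _—↠_

data _⟶_ : Word → Word → Set where
  R1  : ∀ ω ω′ → ω ++ S ∷ S ∷ ω′ ⟶ ω ++ ω′
  R2  : ∀ ω x y ω′ → T^ x ++ T^ y ≢ T^ (x ℤ.+ y) →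
        ω ++ T^ x ++ T^ y ++ ω′ ⟶ ω ++ T^ (x ℤ.+ y) ++ ω′
  R3  : ∀ ω x ys → x ℤ.< 0ℤ →
        TriviallyReduced (ω ++ ∏ (+ 2 ∷ x ∷ ys)) →
        ω ++ ∏ (+ 2 ∷ x ∷ ys) ⟶ ω ++ T ∷ ∏ (ℤ.- + 2 ∷ x ℤ.+ 1ℤ ∷ ys)
  R4  : ∀ ω x ys → 0ℤ ℤ.< x →
        TriviallyReduced (ω ++ ∏ (ℤ.- + 2 ∷ x ∷ ys)) →
        ω ++ ∏ (ℤ.- + 2 ∷ x ∷ ys) ⟶ ω ++ T⁻¹ ∷ ∏ (+ 2 ∷ x ℤ.- 1ℤ ∷ ys)
  R5′ : ∀ ω x ys → x ≢ 0ℤ →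
        TriviallyReduced (ω ++ ∏ (1ℤ ∷ x ∷ ys)) →
        ω ++ ∏ (1ℤ ∷ x ∷ ys) ⟶
        ω ++ T ∷ ∏ (ℤ.- x ℤ.- 1ℤ ∷ map ℤ.-_ ys) ++ [ T ]
  R6′ : ∀ ω x ys → x ≢ 0ℤ →
        TriviallyReduced (ω ++ ∏ (-1ℤ ∷ x ∷ ys)) →
        ω ++ ∏ (-1ℤ ∷ x ∷ ys) ⟶
        ω ++ T⁻¹ ∷ ∏ (ℤ.- x ℤ.+ 1ℤ ∷ map ℤ.-_ ys) ++ [ T ]
  R10 : ∀ ω → TriviallyReduced (ω ++ [ S ]) →
        ω ++ [ S ] ⟶ ω
  R11 : ∀ ω → TriviallyReduced (ω ++ S ∷ [ T ]) →
        ω ++ S ∷ [ T ] ⟶ ω ++ [ T ]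
  R12 : ∀ ω → TriviallyReduced (ω ++ S ∷ T ∷ [ T ]) →
        ω ++ S ∷ T ∷ [ T ] ⟶ ω ++ T ∷ S ∷ [ T⁻¹ ]

_—↠_ : Rel Word _
_—↠_ = Star _⟶_

-- However the rules are applied to ω₁, the process stops, and it stops at ω.

record RewritesTo (ω₁ ω : Word) : Set where
  field
    terminates : Acc (flip _⟶_) ω₁
    reaches    : ω₁ —↠ ω
    reduced    : IsNormalForm _⟶_ ω
    unique     : ∀ {ω′} → ω₁ —↠ ω′ → IsNormalForm _⟶_ ω′ → ω′ ≡ ω

------------------------------------------------------------------------
-- Lattice bases and the Gaussian algorithm

module GaussianAlgorithm {c ℓ₁ ℓ₂} (ℝ : RealField c ℓ₁ ℓ₂) where

  open RealField ℝ

  ℝ² : Set c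
  ℝ² = Carrier × Carrier

  infixl 6 _+ᵥ_ _-ᵥ_
  infixr 7 _*ᵥ_
  infix  7 _·_

  _+ᵥ_ _-ᵥ_ : ℝ² → ℝ² → ℝ²
  (x , y) +ᵥ (x′ , y′) = (x + x′) , (y + y′)
  (x , y) -ᵥ (x′ , y′) = (x - x′) , (y - y′)

  _*ᵥ_ : Carrier → ℝ² → ℝ²
  a *ᵥ (x , y) = (a * x) , (a * y)

  _·_ : ℝ² → ℝ² → Carrier
  (x , y) · (x′ , y′) = x * x′ + y * y′

  ∣_∣ : ℝ² → Carrier
  ∣ v ∣ = √ (v · v)

  -- v differs from the zero vector, in the positive sense of apartness.
  NonZero : ℝ² → Set ℓ₂
  NonZero (x , y) = x # 0# ⊎ y # 0#

  record Pair : Set c where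
    constructor pair
    field
      b₁ b₂ : ℝ²

  open Pair public

  -- b₁ and b₂ are linearly independent over ℝ, that is, (b₁ , b₂) is a basis
  -- of the two-dimensional lattice ℤb₁ + ℤb₂.
  IsLatticeBasis : Pair → Set (c ⊔ ℓ₂)
  IsLatticeBasis B = ∀ α β → α # 0# ⊎ β # 0# → NonZero (α *ᵥ b₁ B +ᵥ β *ᵥ b₂ B)

  m : (B : Pair) → b₁ B · b₁ B # 0# → Carrier
  m B = divide (b₂ B · b₁ B) (b₁ B · b₁ B)

  record Proper (B : Pair) : Set ℓ₂ where
    field
      b₁·b₁#0 : b₁ B · b₁ B # 0#
      -½≤m    : - ½ ≤ m B b₁·b₁#0
      m<½     : m B b₁·b₁#0 < ½

  record Reduced (B : Pair) : Set ℓ₂ where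
    field
      proper    : Proper B
      ∣b₁∣≤∣b₂∣ : ∣ b₁ B ∣ ≤ ∣ b₂ B ∣

    open Proper proper public

  infixr 7 _∙_

  _∙_ : Mat₂ → Pair → Pair
  mat a b c d ∙ pair b₁ b₂ = pair
    (fromℤ a *ᵥ b₁ +ᵥ fromℤ b *ᵥ b₂)
    (fromℤ c *ᵥ b₁ +ᵥ fromℤ d *ᵥ b₂)

  translate : ℤ → Pair → Pair
  translate x (pair b₁ b₂) = pair b₁ (b₂ -ᵥ fromℤ x *ᵥ b₁)

  swap : Pair → Pair
  swap (pair b₁ b₂) = pair b₂ b₁

  -- Run B ω R: on input B the algorithm records ω and outputs R.  Translating
  -- by x lowers m by x, so properness of the new basis forces x = ⌊ m + ½ ⌋,
  -- the nearest integer to m.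
  data Run (B : Pair) : Word → Pair → Set (c ⊔ ℓ₂) where
    stop : ∀ x → Proper (translate x B) →
           ∣ b₁ (translate x B) ∣ ≤ ∣ b₂ (translate x B) ∣ →
           Run B (T^ x) (translate x B)
    next : ∀ x {ω R} → Proper (translate x B) →
           ∣ b₂ (translate x B) ∣ < ∣ b₁ (translate x B) ∣ →
           Run (swap (translate x B)) ω R →
           Run B (T^ x ++ S ∷ ω) R

  -- The output may be a reduced basis of the lattice other than R, so the
  -- value of ω need not be U.
  IsGaussianDecomposition : Pair → Mat₂ → Word → Set (c ⊔ ℓ₂)
  IsGaussianDecomposition R U ω = ∃ (Run (U ∙ R) ω)

{-# OPTIONS --safe #-}
module Submission where

-- The Gauss algorithm sees a basis only through its Gram matrix. For R it is
-- h (2, -1; -1, 2) with h = |b₁|² / 2, so the basis value ω ∙ R has Gram matrix h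
-- times an integral form gram ω, and a run of the algorithm on it is a run on
-- the form, where it is deterministic. Every rule preserves gram, since each
-- multiplies the value of the word on the right by an automorphism of the
-- hexagonal form. The rules terminate: they decrease the number of
-- letters S or, that number being equal, the sum over the letters T^±1 of the
-- number of letters S to their left plus one. A word to which no rule applies
-- records a run on its own form. So every maximal rewriting of ω₁ ends in the
-- word recorded on gram ω₁. Conversely that word is irreducible, as any step
-- from it would lead back to it.

open import Defs
open import Algebra.Bundles using (CommutativeRing)
open import Algebra.Core using (Op₁; Op₂)
import Algebra.Apartness.Properties.HeytingCommutativeRing
import Algebra.Properties.AbelianGroup
import Algebra.Properties.Ring
import Algebra.Properties.Semiring.Mult
import Algebra.Solver.Ring
open import Algebra.Solver.Ring.AlmostCommutativeRing
  using (AlmostCommutativeRing; fromCommutativeRing; _-Raw-AlmostCommutative⟶_)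
open import Data.Fin.Base using (zero; suc)
open import Data.Integer.Base as ℤ using (ℤ; +_; +[1+_]; -[1+_]; 0ℤ; 1ℤ; -1ℤ; -<+; +<+; +≤+)
import Data.Integer.Properties as ℤₚ
open import Data.Integer.Solver using (module +-*-Solver)
open import Data.List.Base
  using (List; length; []; _∷_; _++_; _∷ʳ_; [_]; map; replicate)
open import Data.List.Properties using (++-assoc; ++-identityʳ; length-map)
open import Data.List.Relation.Unary.All using (All; []; _∷_)
open import Data.Maybe.Base using (Maybe; just; nothing)
open import Data.Nat.Base as ℕ using (ℕ; zero; suc)
open import Data.Nat.Induction using (<-wellFounded)
import Data.Nat.Properties as ℕₚ
open import Data.Nat.Tactic.RingSolver using (solve-∀)
open import Data.Product using (Σ; ∃; ∃!; _×_; _,_; proj₂)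
open import Data.Product.Relation.Binary.Lex.Strict using (×-Lex; ×-wellFounded)
open import Data.Sum.Base using (_⊎_; inj₁; inj₂; [_,_]′)
open import Data.Vec.Base as Vec using (Vec)
open import Function.Base using (flip; _∘_)
open import Induction.WellFounded using (Acc; acc; WellFounded; module Subrelation)
open import Relation.Binary.Construct.Closure.ReflexiveTransitive using (ε; _◅_; _◅◅_)
import Relation.Binary.Construct.On as On
open import Relation.Binary.Definitions using (tri<; tri≈; tri>)
open import Relation.Binary.PropositionalEquality as ≡ using (_≡_; _≢_)
import Relation.Binary.Reasoning.Setoid as SetoidReasoning
open import Relation.Binary.Rewriting using (IsNormalForm)
open import Relation.Binary.Structures using (IsStrictPartialOrder)
open import Relation.Nullary.Decidable using (yes; no)
open import Relation.Nullary.Negation using (¬_; contradiction)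

-- form a b c stands for the symmetric matrix (a, b; b, c).
record Form {ℓ} (A : Set ℓ) : Set ℓ where
  constructor form
  field
    a b c : A

-- With the operations as parameters, the same formulas serve over the integers and over the
-- polynomials of the ring solver. On the Gram matrix of a basis, `flipᶠ` is the swap of the two
-- vectors, `mirror` a change of sign of one of them, and `shear x` the addition of x times the
-- first vector to the second.
module FormOperations {ℓ} {A : Set ℓ} (_+_ _*_ : Op₂ A) (-_ : Op₁ A) where

  flipᶠ mirror : Form A → Form A
  flipᶠ (form a b c)  = form c b a
  mirror (form a b c) = form a (- b) c

  shear : A → Form A → Form A
  shear x (form a b c) = form a (b + (x * a)) ((c + (x * (b + b))) + (x * (x * a)))

-- Integral binary quadratic forms and the identities behind the rules.

module IntegralForms where

  open import Data.Integer.Base using (_+_; _*_; -_; _-_; _≤_; _<_)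
  open ≡ using (refl; sym; trans; cong; subst; subst₂; module ≡-Reasoning)
  open FormOperations _+_ _*_ -_ public

  open +-*-Solver using (Polynomial; solve; con; _:+_; _:*_; _:-_; :-_; _:=_)

  form-cong : ∀ {a a′ b b′ c c′ : ℤ} → a ≡ a′ → b ≡ b′ → c ≡ c′ →
              form a b c ≡ form a′ b′ c′
  form-cong refl refl refl = refl

  module FormIdentities where
    open +-*-Solver using (var; ⟦_⟧; ⟦_⟧↓; prove)

    module P {n} = FormOperations {A = Polynomial n} _:+_ _:*_ :-_

    ⟦_⟧ᶠ ⟦_⟧ᶠ↓ : ∀ {n} → Form (Polynomial n) → Vec ℤ n → Form ℤ
    ⟦ form p q r ⟧ᶠ ρ  = form (⟦ p ⟧ ρ) (⟦ q ⟧ ρ) (⟦ r ⟧ ρ)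
    ⟦ form p q r ⟧ᶠ↓ ρ = form (⟦ p ⟧↓ ρ) (⟦ q ⟧↓ ρ) (⟦ r ⟧↓ ρ)

    -- A single `refl` between the normalised forms splits into the three equations that the solver
    -- asks for, one for each entry.
    prove-form : ∀ {n} (ρ : Vec ℤ n) F G → ⟦ F ⟧ᶠ↓ ρ ≡ ⟦ G ⟧ᶠ↓ ρ → ⟦ F ⟧ᶠ ρ ≡ ⟦ G ⟧ᶠ ρ
    prove-form ρ (form p q r) (form p′ q′ r′) eq = form-cong
      (prove ρ p p′ (cong Form.a eq)) (prove ρ q q′ (cong Form.b eq)) (prove ρ r r′ (cong Form.c eq))

    𝐱 𝐲 : Polynomial 5
    𝐱 = var zero
    𝐲 = var (suc zero)

    𝐟 : Form (Polynomial 5)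
    𝐟 = form (var (suc (suc zero))) (var (suc (suc (suc zero)))) (var (suc (suc (suc (suc zero)))))

    env : ℤ → ℤ → Form ℤ → Vec ℤ 5
    env x y (form a b c) = x Vec.∷ y Vec.∷ a Vec.∷ b Vec.∷ c Vec.∷ Vec.[]

  open FormIdentities

  shear-0 : ∀ f → shear 0ℤ f ≡ f
  shear-0 g = prove-form (env 0ℤ 0ℤ g) (P.shear (con 0ℤ) 𝐟) 𝐟 refl

  shear-+ : ∀ x y f → shear x (shear y f) ≡ shear (x + y) f
  shear-+ i j g = prove-form (env i j g) (P.shear 𝐱 (P.shear 𝐲 𝐟)) (P.shear (𝐱 :+ 𝐲) 𝐟) refl

  mirror-shear : ∀ x f → mirror (shear x f) ≡ shear (- x) (mirror f)
  mirror-shear i g = prove-form (env i 0ℤ g)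
    (P.mirror (P.shear 𝐱 𝐟)) (P.shear (:- 𝐱) (P.mirror 𝐟)) refl

  -- The two sides of R3 are opposite matrices, and a form does not change when both basis vectors
  -- change sign. R4 is of the same kind.
  shear-R3 : ∀ x f → flipᶠ (shear (+ 2) (flipᶠ (shear x f))) ≡
    shear 1ℤ (flipᶠ (shear (- + 2) (flipᶠ (shear (x + 1ℤ) f))))
  shear-R3 i g = prove-form (env i 0ℤ g)
    (P.flipᶠ (P.shear (con (+ 2)) (P.flipᶠ (P.shear 𝐱 𝐟))))
    (P.shear (con 1ℤ) (P.flipᶠ (P.shear (con (- + 2)) (P.flipᶠ (P.shear (𝐱 :+ con 1ℤ) 𝐟)))))
    refl

  shear-R4 : ∀ x f → flipᶠ (shear (- + 2) (flipᶠ (shear x f))) ≡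
    shear -1ℤ (flipᶠ (shear (+ 2) (flipᶠ (shear (x - 1ℤ) f))))
  shear-R4 i g = prove-form (env i 0ℤ g)
    (P.flipᶠ (P.shear (con (- + 2)) (P.flipᶠ (P.shear 𝐱 𝐟))))
    (P.shear (con -1ℤ) (P.flipᶠ (P.shear (con (+ 2)) (P.flipᶠ (P.shear (𝐱 :- con 1ℤ) 𝐟)))))
    refl

  -- The right-hand side has one S less, so the determinants differ in sign. Changing the sign of
  -- one basis vector makes up for it, and on forms this is `mirror`.
  shear-R5′ : ∀ x f → flipᶠ (shear 1ℤ (flipᶠ (shear x f))) ≡
    shear 1ℤ (flipᶠ (shear (- x - 1ℤ) (mirror f)))
  shear-R5′ i g = prove-form (env i 0ℤ g)
    (P.flipᶠ (P.shear (con 1ℤ) (P.flipᶠ (P.shear 𝐱 𝐟))))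
    (P.shear (con 1ℤ) (P.flipᶠ (P.shear (:- 𝐱 :- con 1ℤ) (P.mirror 𝐟))))
    refl

  shear-R6′ : ∀ x f → flipᶠ (shear -1ℤ (flipᶠ (shear x f))) ≡
    shear -1ℤ (flipᶠ (shear (- x + 1ℤ) (mirror f)))
  shear-R6′ i g = prove-form (env i 0ℤ g)
    (P.flipᶠ (P.shear (con -1ℤ) (P.flipᶠ (P.shear 𝐱 𝐟))))
    (P.shear (con -1ℤ) (P.flipᶠ (P.shear (:- 𝐱 :+ con 1ℤ) (P.mirror 𝐟))))
    refl

  -- The form of a word and its invariance under the rules.

  gram : Word → Form ℤ
  gram []        = form (+ 2) -1ℤ (+ 2)
  gram (S ∷ w)   = flipᶠ (gram w)
  gram (T ∷ w)   = shear 1ℤ (gram w)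
  gram (T⁻¹ ∷ w) = shear -1ℤ (gram w)

  -- A prefix acts on the form of what follows it, so a rule has to be checked only from its redex
  -- to the right end of the word.
  gram-++ : ∀ ω {u v} → gram u ≡ gram v → gram (ω ++ u) ≡ gram (ω ++ v)
  gram-++ []        eq = eq
  gram-++ (S ∷ ω)   eq = cong flipᶠ (gram-++ ω eq)
  gram-++ (T ∷ ω)   eq = cong (shear 1ℤ) (gram-++ ω eq)
  gram-++ (T⁻¹ ∷ ω) eq = cong (shear -1ℤ) (gram-++ ω eq)

  gram-T^ : ∀ x w → gram (T^ x ++ w) ≡ shear x (gram w)
  gram-T^ (+ zero)     w = sym (shear-0 (gram w))
  gram-T^ (+ suc n)    w = trans (cong (shear 1ℤ) (gram-T^ (+ n) w)) (shear-+ 1ℤ (+ n) (gram w))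
  gram-T^ -[1+ zero ]  w = refl
  gram-T^ -[1+ suc n ] w =
    trans (cong (shear -1ℤ) (gram-T^ -[1+ n ] w)) (shear-+ -1ℤ -[1+ n ] (gram w))

  gram-∏ : ∀ x ys → gram (∏ (x ∷ ys)) ≡ flipᶠ (shear x (gram (∏ ys)))
  gram-∏ x ys = cong flipᶠ (gram-T^ x (∏ ys))

  ∏-∷-++ : ∀ x ys w → ∏ (x ∷ ys) ++ w ≡ S ∷ T^ x ++ ∏ ys ++ w
  ∏-∷-++ x ys w = cong (S ∷_) (++-assoc (T^ x) (∏ ys) w)

  gram-∏-++ : ∀ x ys w → gram (∏ (x ∷ ys) ++ w) ≡ flipᶠ (shear x (gram (∏ ys ++ w)))
  gram-∏-++ x ys w = trans (cong gram (∏-∷-++ x ys w)) (cong flipᶠ (gram-T^ x (∏ ys ++ w)))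

  -- The change of sign travels to the right through the product, negating each exponent, until it
  -- meets the hexagonal form, where `mirror` and `shear 1ℤ` both give (2, 1; 1, 2). This is the
  -- origin of the final T in R5′ and R6′.
  gram-∏-mirror : ∀ ys → gram (∏ (map -_ ys) ++ [ T ]) ≡ mirror (gram (∏ ys))
  gram-∏-mirror []       = refl
  gram-∏-mirror (y ∷ ys) = begin
    gram (∏ (map -_ (y ∷ ys)) ++ [ T ])                  ≡⟨ gram-∏-++ (- y) (map -_ ys) [ T ] ⟩
    flipᶠ (shear (- y) (gram (∏ (map -_ ys) ++ [ T ])))  ≡⟨ cong (λ f → flipᶠ (shear (- y) f)) (gram-∏-mirror ys) ⟩
    flipᶠ (shear (- y) (mirror (gram (∏ ys))))           ≡⟨ cong flipᶠ (mirror-shear y (gram (∏ ys))) ⟨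
    mirror (flipᶠ (shear y (gram (∏ ys))))               ≡⟨ cong mirror (gram-∏ y ys) ⟨
    mirror (gram (∏ (y ∷ ys)))                           ∎
    where open ≡-Reasoning

  gram-∏₂ : ∀ x y ys → gram (∏ (x ∷ y ∷ ys)) ≡ flipᶠ (shear x (flipᶠ (shear y (gram (∏ ys)))))
  gram-∏₂ x y ys = trans (gram-∏ x (y ∷ ys)) (cong (λ f → flipᶠ (shear x f)) (gram-∏ y ys))

  gram-∏-mirror₂ : ∀ x ys →
    gram (∏ (x ∷ map -_ ys) ++ [ T ]) ≡ flipᶠ (shear x (mirror (gram (∏ ys))))
  gram-∏-mirror₂ x ys =
    trans (gram-∏-++ x (map -_ ys) [ T ]) (cong (λ f → flipᶠ (shear x f)) (gram-∏-mirror ys))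

  gram-⟶ : ∀ {u v} → u ⟶ v → gram u ≡ gram v
  gram-⟶ (R1 ω ω′)       = gram-++ ω refl
  gram-⟶ (R2 ω x y ω′ _) = gram-++ ω (begin
    gram (T^ x ++ T^ y ++ ω′)      ≡⟨ gram-T^ x (T^ y ++ ω′) ⟩
    shear x (gram (T^ y ++ ω′))    ≡⟨ cong (shear x) (gram-T^ y ω′) ⟩
    shear x (shear y (gram ω′))    ≡⟨ shear-+ x y (gram ω′) ⟩
    shear (x + y) (gram ω′)        ≡⟨ gram-T^ (x + y) ω′ ⟨
    gram (T^ (x + y) ++ ω′)        ∎)
    where open ≡-Reasoning
  gram-⟶ (R3 ω x ys _ _) = gram-++ ω
    (trans (gram-∏₂ (+ 2) x ys)
      (trans (shear-R3 x (gram (∏ ys))) (cong (shear 1ℤ) (sym (gram-∏₂ (- + 2) (x + 1ℤ) ys)))))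
  gram-⟶ (R4 ω x ys _ _) = gram-++ ω
    (trans (gram-∏₂ (- + 2) x ys)
      (trans (shear-R4 x (gram (∏ ys))) (cong (shear -1ℤ) (sym (gram-∏₂ (+ 2) (x - 1ℤ) ys)))))
  gram-⟶ (R5′ ω x ys _ _) = gram-++ ω
    (trans (gram-∏₂ 1ℤ x ys)
      (trans (shear-R5′ x (gram (∏ ys))) (cong (shear 1ℤ) (sym (gram-∏-mirror₂ (- x - 1ℤ) ys)))))
  gram-⟶ (R6′ ω x ys _ _) = gram-++ ω
    (trans (gram-∏₂ -1ℤ x ys)
      (trans (shear-R6′ x (gram (∏ ys))) (cong (shear -1ℤ) (sym (gram-∏-mirror₂ (- x + 1ℤ) ys)))))
  -- At the right end of the word the form is known, so the last three rules are evaluations: both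
  -- sides of R12, for instance, give (6, 3; 3, 2).
  gram-⟶ (R10 ω _) = trans (gram-++ ω refl) (cong gram (++-identityʳ ω))
  gram-⟶ (R11 ω _) = gram-++ ω refl
  gram-⟶ (R12 ω _) = gram-++ ω refl

  -- Left multiplication by the value of a letter.

  mat-cong : ∀ {a a′ b b′ c c′ d d′} → a ≡ a′ → b ≡ b′ → c ≡ c′ → d ≡ d′ →
             mat a b c d ≡ mat a′ b′ c′ d′
  mat-cong refl refl refl refl = refl

  1x+0y≡x : ∀ x y → 1ℤ * x + 0ℤ * y ≡ x
  1x+0y≡x = solve 2 (λ x y → con 1ℤ :* x :+ con 0ℤ :* y := x) refl

  S-⊗ : ∀ a b c d → letterValue S ⊗ mat a b c d ≡ mat c d a b
  S-⊗ a b c d = mat-cong (l a c) (l b d) (1x+0y≡x a c) (1x+0y≡x b d)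
    where
    l : ∀ x y → 0ℤ * x + 1ℤ * y ≡ y
    l = solve 2 (λ x y → con 0ℤ :* x :+ con 1ℤ :* y := y) refl

  T-⊗ : ∀ a b c d → letterValue T ⊗ mat a b c d ≡ mat a b (c + a) (d + b)
  T-⊗ a b c d = mat-cong (1x+0y≡x a c) (1x+0y≡x b d) (l a c) (l b d)
    where
    l : ∀ x y → 1ℤ * x + 1ℤ * y ≡ y + x
    l = solve 2 (λ x y → con 1ℤ :* x :+ con 1ℤ :* y := y :+ x) refl

  T⁻¹-⊗ : ∀ a b c d → letterValue T⁻¹ ⊗ mat a b c d ≡ mat a b (c - a) (d - b)
  T⁻¹-⊗ a b c d = mat-cong (1x+0y≡x a c) (1x+0y≡x b d) (l a c) (l b d)
    where
    l : ∀ x y → -1ℤ * x + 1ℤ * y ≡ y - x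
    l = solve 2 (λ x y → con -1ℤ :* x :+ con 1ℤ :* y := y :- x) refl

  -- Termination

  swaps : Word → ℕ
  swaps []        = 0
  swaps (S ∷ w)   = suc (swaps w)
  swaps (T ∷ w)   = swaps w
  swaps (T⁻¹ ∷ w) = swaps w

  -- n letters S precede the word. R3, R4 and R12 move letters T^±1 to the left past
  -- an S.
  weight : ℕ → Word → ℕ
  weight n []        = 0
  weight n (S ∷ w)   = weight (suc n) w
  weight n (T ∷ w)   = suc n ℕ.+ weight n w
  weight n (T⁻¹ ∷ w) = suc n ℕ.+ weight n w

  swaps-++ : ∀ u v → swaps (u ++ v) ≡ swaps u ℕ.+ swaps v
  swaps-++ []        v = refl
  swaps-++ (S ∷ u)   v = cong suc (swaps-++ u v)
  swaps-++ (T ∷ u)   v = swaps-++ u v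
  swaps-++ (T⁻¹ ∷ u) v = swaps-++ u v

  swaps-T^ : ∀ x w → swaps (T^ x ++ w) ≡ swaps w
  swaps-T^ (+ zero)     w = refl
  swaps-T^ (+ suc n)    w = swaps-T^ (+ n) w
  swaps-T^ -[1+ zero ]  w = refl
  swaps-T^ -[1+ suc n ] w = swaps-T^ -[1+ n ] w

  swaps-∏-++ : ∀ ys w → swaps (∏ ys ++ w) ≡ length ys ℕ.+ swaps w
  swaps-∏-++ []       w = refl
  swaps-∏-++ (y ∷ ys) w = trans (cong swaps (∏-∷-++ y ys w))
    (cong suc (trans (swaps-T^ y (∏ ys ++ w)) (swaps-∏-++ ys w)))

  swaps-∏ : ∀ ys → swaps (∏ ys) ≡ length ys
  swaps-∏ []       = refl
  swaps-∏ (y ∷ ys) = cong suc (trans (swaps-T^ y (∏ ys)) (swaps-∏ ys))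

  weight-++ : ∀ n u v → weight n (u ++ v) ≡ weight n u ℕ.+ weight (swaps u ℕ.+ n) v
  weight-++ n []        v = refl
  weight-++ n (S ∷ u)   v = trans (weight-++ (suc n) u v)
    (cong (λ k → weight (suc n) u ℕ.+ weight k v) (ℕₚ.+-suc (swaps u) n))
  weight-++ n (T ∷ u)   v = trans (cong (suc n ℕ.+_) (weight-++ n u v))
    (sym (ℕₚ.+-assoc (suc n) (weight n u) _))
  weight-++ n (T⁻¹ ∷ u) v = trans (cong (suc n ℕ.+_) (weight-++ n u v))
    (sym (ℕₚ.+-assoc (suc n) (weight n u) _))

  weight-T^ : ∀ n x w → weight n (T^ x ++ w) ≡ ℤ.∣ x ∣ ℕ.* suc n ℕ.+ weight n w
  weight-T^ n (+ zero)     w = refl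
  weight-T^ n (+ suc k)    w = trans (cong (suc n ℕ.+_) (weight-T^ n (+ k) w))
    (sym (ℕₚ.+-assoc (suc n) (k ℕ.* suc n) _))
  weight-T^ n -[1+ zero ]  w = cong (ℕ._+ weight n w) (sym (ℕₚ.*-identityˡ (suc n)))
  weight-T^ n -[1+ suc k ] w = trans (cong (suc n ℕ.+_) (weight-T^ n -[1+ k ] w))
    (sym (ℕₚ.+-assoc (suc n) (suc k ℕ.* suc n) _))

  infix 4 _≺_

  -- The weights are compared for every starting count `n`, because a prefix shifts the number of
  -- letters S that precede the redex.
  _≺_ : Word → Word → Set
  v ≺ u = swaps v ℕ.< swaps u ⊎ (swaps v ≡ swaps u × (∀ n → weight n v ℕ.< weight n u))

  ≺-++ : ∀ ω {u v} → v ≺ u → ω ++ v ≺ ω ++ u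
  ≺-++ ω {u} {v} (inj₁ lt) = inj₁ (begin-strict
    swaps (ω ++ v)        ≡⟨ swaps-++ ω v ⟩
    swaps ω ℕ.+ swaps v   <⟨ ℕₚ.+-monoʳ-< (swaps ω) lt ⟩
    swaps ω ℕ.+ swaps u   ≡⟨ swaps-++ ω u ⟨
    swaps (ω ++ u)        ∎)
    where open ℕₚ.≤-Reasoning
  ≺-++ ω {u} {v} (inj₂ (eq , lt)) = inj₂
    ( trans (swaps-++ ω v) (trans (cong (swaps ω ℕ.+_) eq) (sym (swaps-++ ω u)))
    , λ n → begin-strict
      weight n (ω ++ v)                             ≡⟨ weight-++ n ω v ⟩
      weight n ω ℕ.+ weight (swaps ω ℕ.+ n) v       <⟨ ℕₚ.+-monoʳ-< (weight n ω) (lt _) ⟩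
      weight n ω ℕ.+ weight (swaps ω ℕ.+ n) u       ≡⟨ weight-++ n ω u ⟨
      weight n (ω ++ u)                             ∎ )
    where open ℕₚ.≤-Reasoning

  ∣1+m⊖1+n∣<2+m+n : ∀ m n → ℤ.∣ suc m ℤ.⊖ suc n ∣ ℕ.< suc m ℕ.+ suc n
  ∣1+m⊖1+n∣<2+m+n m n = begin-strict
    ℤ.∣ suc m ℤ.⊖ suc n ∣  ≡⟨ cong ℤ.∣_∣ (ℤₚ.[1+m]⊖[1+n]≡m⊖n m n) ⟩
    ℤ.∣ m ℤ.⊖ n ∣          ≡⟨ cong ℤ.∣_∣ (ℤₚ.m-n≡m⊖n m n) ⟨
    ℤ.∣ + m - + n ∣        ≤⟨ ℤₚ.∣i-j∣≤∣i∣+∣j∣ (+ m) (+ n) ⟩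
    m ℕ.+ n                <⟨ ℕₚ.+-mono-<-≤ (ℕₚ.n<1+n m) (ℕₚ.n≤1+n n) ⟩
    suc m ℕ.+ suc n        ∎
    where open ℕₚ.≤-Reasoning

  replicate-+ : ∀ {a} {A : Set a} m n (x : A) →
                replicate m x ++ replicate n x ≡ replicate (m ℕ.+ n) x
  replicate-+ zero    n x = refl
  replicate-+ (suc m) n x = cong (x ∷_) (replicate-+ m n x)

  -- If the signs agree or an exponent is zero, then the two words coincide, which the hypothesis
  -- excludes. In the remaining case of opposite signs letters cancel.
  ∣x+y∣<∣x∣+∣y∣ : ∀ x y → T^ x ++ T^ y ≢ T^ (x + y) → ℤ.∣ x + y ∣ ℕ.< ℤ.∣ x ∣ ℕ.+ ℤ.∣ y ∣
  ∣x+y∣<∣x∣+∣y∣ (+ m)     (+ n)     neq = contradiction (replicate-+ m n T) neq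
  ∣x+y∣<∣x∣+∣y∣ (+ zero)  -[1+ n ]  neq = contradiction refl neq
  ∣x+y∣<∣x∣+∣y∣ (+ suc m) -[1+ n ]  neq = ∣1+m⊖1+n∣<2+m+n m n
  ∣x+y∣<∣x∣+∣y∣ -[1+ m ]  (+ zero)  neq = contradiction (++-identityʳ (T^ -[1+ m ])) neq
  ∣x+y∣<∣x∣+∣y∣ -[1+ m ]  (+ suc n) neq =
    subst (ℤ.∣ suc n ℤ.⊖ suc m ∣ ℕ.<_) (ℕₚ.+-comm (suc n) (suc m)) (∣1+m⊖1+n∣<2+m+n n m)
  ∣x+y∣<∣x∣+∣y∣ -[1+ m ]  -[1+ n ]  neq = contradiction
    (trans (replicate-+ (suc m) (suc n) T⁻¹) (cong (λ k → replicate (suc k) T⁻¹) (ℕₚ.+-suc m n))) neq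

  ∣x∣≡1+∣x+1∣ : ∀ {x} → x ℤ.< 0ℤ → ℤ.∣ x ∣ ≡ suc ℤ.∣ x + 1ℤ ∣
  ∣x∣≡1+∣x+1∣ {+ _} (ℤ.+<+ ())
  ∣x∣≡1+∣x+1∣ { -[1+ zero ]}  _ = refl
  ∣x∣≡1+∣x+1∣ { -[1+ suc k ]} _ = refl

  ∣x∣≡1+∣x-1∣ : ∀ {x} → 0ℤ ℤ.< x → ℤ.∣ x ∣ ≡ suc ℤ.∣ x - 1ℤ ∣
  ∣x∣≡1+∣x-1∣ {+ suc k} _ = refl
  ∣x∣≡1+∣x-1∣ {+ zero} (ℤ.+<+ ())

  -- In R3 and R4 the sign of x makes the last exponent one letter shorter. That letter costs n + 3,
  -- and the new letter in front costs n + 1, so the weight drops by exactly 2.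
  weight-decrease : ∀ n {k l u v W} → k ≡ suc l →
    u ≡ k ℕ.* suc (suc (suc n)) ℕ.+ W → v ≡ l ℕ.* suc (suc (suc n)) ℕ.+ W →
    suc n ℕ.+ (suc (suc n) ℕ.+ (suc (suc n) ℕ.+ v)) ℕ.< suc (suc n) ℕ.+ (suc (suc n) ℕ.+ u)
  weight-decrease n {l = l} {u} {v} {W} refl refl refl =
    subst (suc n ℕ.+ (suc (suc n) ℕ.+ (suc (suc n) ℕ.+ v)) ℕ.<_) (eq n l W) (ℕₚ.m<n+m _ (ℕ.z<s {1}))
    where
    eq : ∀ n l W →
         2 ℕ.+ (suc n ℕ.+ (suc (suc n) ℕ.+ (suc (suc n) ℕ.+ (l ℕ.* suc (suc (suc n)) ℕ.+ W)))) ≡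
         suc (suc n) ℕ.+ (suc (suc n) ℕ.+ (suc l ℕ.* suc (suc (suc n)) ℕ.+ W))
    eq = solve-∀

  swaps-R5′ : ∀ x y z ys →
    swaps (∏ (z ∷ map -_ ys) ++ [ T ]) ℕ.< swaps (∏ (x ∷ y ∷ ys))
  swaps-R5′ x y z ys = begin-strict
    swaps (∏ (z ∷ map -_ ys) ++ [ T ])  ≡⟨ swaps-∏-++ (z ∷ map -_ ys) [ T ] ⟩
    suc (length (map -_ ys)) ℕ.+ 0      ≡⟨ ℕₚ.+-identityʳ _ ⟩
    suc (length (map -_ ys))            ≡⟨ cong suc (length-map -_ ys) ⟩
    suc (length ys)                     <⟨ ℕₚ.n<1+n _ ⟩
    suc (suc (length ys))               ≡⟨ swaps-∏ (x ∷ y ∷ ys) ⟨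
    swaps (∏ (x ∷ y ∷ ys))              ∎
    where open ℕₚ.≤-Reasoning

  ⟶⇒≺ : ∀ {u v} → u ⟶ v → v ≺ u
  ⟶⇒≺ (R1 ω ω′)     = ≺-++ ω (inj₁ (ℕₚ.m<n+m _ ℕ.z<s))
  ⟶⇒≺ (R2 ω x y ω′ neq) = ≺-++ ω (inj₂
    ( trans (swaps-T^ (x + y) ω′) (sym (trans (swaps-T^ x (T^ y ++ ω′)) (swaps-T^ y ω′)))
    , λ n → begin-strict
      weight n (T^ (x + y) ++ ω′)
        ≡⟨ weight-T^ n (x + y) ω′ ⟩
      ℤ.∣ x + y ∣ ℕ.* suc n ℕ.+ weight n ω′
        <⟨ ℕₚ.+-monoˡ-< _ (ℕₚ.*-monoˡ-< (suc n) (∣x+y∣<∣x∣+∣y∣ x y neq)) ⟩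
      (ℤ.∣ x ∣ ℕ.+ ℤ.∣ y ∣) ℕ.* suc n ℕ.+ weight n ω′
        ≡⟨ cong (ℕ._+ weight n ω′) (ℕₚ.*-distribʳ-+ (suc n) ℤ.∣ x ∣ ℤ.∣ y ∣) ⟩
      ℤ.∣ x ∣ ℕ.* suc n ℕ.+ ℤ.∣ y ∣ ℕ.* suc n ℕ.+ weight n ω′
        ≡⟨ ℕₚ.+-assoc (ℤ.∣ x ∣ ℕ.* suc n) _ _ ⟩
      ℤ.∣ x ∣ ℕ.* suc n ℕ.+ (ℤ.∣ y ∣ ℕ.* suc n ℕ.+ weight n ω′)
        ≡⟨ cong (ℤ.∣ x ∣ ℕ.* suc n ℕ.+_) (weight-T^ n y ω′) ⟨
      ℤ.∣ x ∣ ℕ.* suc n ℕ.+ weight n (T^ y ++ ω′)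
        ≡⟨ weight-T^ n x (T^ y ++ ω′) ⟨
      weight n (T^ x ++ T^ y ++ ω′) ∎ ))
    where open ℕₚ.≤-Reasoning
  ⟶⇒≺ (R3 ω x ys x<0 _) = ≺-++ ω (inj₂
    ( trans (swaps-∏ (- + 2 ∷ x + 1ℤ ∷ ys)) (sym (swaps-∏ (+ 2 ∷ x ∷ ys)))
    , λ n → weight-decrease n (∣x∣≡1+∣x+1∣ x<0) (weight-T^ (suc (suc n)) x (∏ ys))
              (weight-T^ (suc (suc n)) (x + 1ℤ) (∏ ys))))
  ⟶⇒≺ (R4 ω x ys 0<x _) = ≺-++ ω (inj₂
    ( trans (swaps-∏ (+ 2 ∷ x - 1ℤ ∷ ys)) (sym (swaps-∏ (- + 2 ∷ x ∷ ys)))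
    , λ n → weight-decrease n (∣x∣≡1+∣x-1∣ 0<x) (weight-T^ (suc (suc n)) x (∏ ys))
              (weight-T^ (suc (suc n)) (x - 1ℤ) (∏ ys))))
  ⟶⇒≺ (R5′ ω x ys _ _) = ≺-++ ω (inj₁ (swaps-R5′ 1ℤ x (- x - 1ℤ) ys))
  ⟶⇒≺ (R6′ ω x ys _ _) = ≺-++ ω (inj₁ (swaps-R5′ -1ℤ x (- x + 1ℤ) ys))
  ⟶⇒≺ (R10 ω _) = subst (_≺ ω ++ [ S ]) (++-identityʳ ω) (≺-++ ω (inj₁ ℕ.z<s))
  ⟶⇒≺ (R11 ω _) = ≺-++ ω (inj₁ ℕ.z<s)
  ⟶⇒≺ (R12 ω _) = ≺-++ ω (inj₂ (refl , λ n → ℕₚ.+-monoˡ-< (suc (suc n) ℕ.+ 0) (ℕₚ.n<1+n (suc n))))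

  ⟶-wellFounded : WellFounded (flip _⟶_)
  ⟶-wellFounded = Subrelation.wellFounded ⟶⇒lex
    (On.wellFounded (λ w → swaps w , weight 0 w) (×-wellFounded <-wellFounded <-wellFounded))
    where
    ⟶⇒lex : ∀ {v u} → u ⟶ v → ×-Lex _≡_ ℕ._<_ ℕ._<_ (swaps v , weight 0 v) (swaps u , weight 0 u)
    ⟶⇒lex r with ⟶⇒≺ r
    ... | inj₁ lt        = inj₁ lt
    ... | inj₂ (eq , lt) = inj₂ (eq , lt 0)

  -- The algorithm on integral forms

  -- This is -1/2 ≤ b/a < 1/2 cleared of denominators; the sum of the two inequalities is 0 < 2a.
  record Properᶠ (f : Form ℤ) : Set where
    open Form f
    field
      -a≤2b : 0ℤ ≤ a + (b + b)
      2b<a  : 0ℤ < a - (b + b)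

  data Runᶠ (f : Form ℤ) : Word → Set where
    stop : ∀ x (let g = shear (- x) f) → Properᶠ g → Form.a g ≤ Form.c g → Runᶠ f (T^ x)
    next : ∀ x {ω} (let g = shear (- x) f) → Properᶠ g → Form.c g < Form.a g →
           Runᶠ (flipᶠ g) ω → Runᶠ f (T^ x ++ S ∷ ω)

  0≤+ : ∀ {x y} → 0ℤ ≤ x → 0ℤ ≤ y → 0ℤ ≤ x + y
  0≤+ = ℤₚ.+-mono-≤

  0≤* : ∀ {x y} → 0ℤ ≤ x → 0ℤ ≤ y → 0ℤ ≤ x * y
  0≤* {+ m} {+ n} _ _ = subst (0ℤ ≤_) (ℤₚ.pos-* m n) (+≤+ ℕ.z≤n)

  0<+ : ∀ {x y} → 0ℤ < x → 0ℤ ≤ y → 0ℤ < x + y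
  0<+ = ℤₚ.+-mono-<-≤

  0<j-i⇒i<j : ∀ {i j} → 0ℤ < j - i → i < j
  0<j-i⇒i<j {i} {j} 0<j-i = subst₂ _<_ (ℤₚ.+-identityʳ i)
    (solve 2 (λ i j → i :+ (j :- i) := j) refl i j) (ℤₚ.+-monoʳ-< i 0<j-i)

  proper⇒0<2a : ∀ f → Properᶠ f → 0ℤ < Form.a f + Form.a f
  proper⇒0<2a (form a b c) p = subst (0ℤ <_)
    (solve 2 (λ a b → (a :- (b :+ b)) :+ (a :+ (b :+ b)) := a :+ a) refl a b)
    (0<+ (Properᶠ.2b<a p) (Properᶠ.-a≤2b p))

  proper⇒0<a : ∀ f → Properᶠ f → 0ℤ < Form.a f
  proper⇒0<a f p with Form.a f | proper⇒0<2a f p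
  ... | +[1+ _ ] | _      = +<+ ℕ.z<s
  ... | + zero   | +<+ ()
  ... | -[1+ _ ] | ()

  -- The translated values of b/a lie in a half-open interval of length 1, so y - x < 1, whereas x <
  -- y gives y - x ≥ 1. The three inequalities added up read 0 < 0.
  proper-≮ : ∀ {x y} f → Properᶠ (shear (- x) f) → Properᶠ (shear (- y) f) → ¬ x < y
  proper-≮ {x} {y} f@(form a b c) p q x<y = ℤₚ.<-irrefl refl (subst (0ℤ <_)
    (solve 4 (λ a b x y →
      let d = b :+ :- x :* a ; e = b :+ :- y :* a in
      (a :- (d :+ d)) :+ (a :+ (e :+ e)) :+ (y :- (con 1ℤ :+ x)) :* (a :+ a) := con 0ℤ)
      refl a b x y)
    (0<+ (0<+ (2b<a p) (-a≤2b q))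
      (0≤* (ℤₚ.i≤j⇒0≤j-i (ℤₚ.i<j⇒suc[i]≤j x<y)) (ℤₚ.<⇒≤ (proper⇒0<2a (shear (- x) f) p)))))
    where open Properᶠ

  proper-unique : ∀ x y f → Properᶠ (shear (- x) f) → Properᶠ (shear (- y) f) → x ≡ y
  proper-unique x y f p q with ℤₚ.<-cmp x y
  ... | tri< x<y _ _ = contradiction x<y (proper-≮ f p q)
  ... | tri≈ _ x≡y _ = x≡y
  ... | tri> _ _ y<x = contradiction y<x (proper-≮ f q p)

  Runᶠ-deterministic : ∀ {f u v} → Runᶠ f u → Runᶠ f v → u ≡ v
  Runᶠ-deterministic {f} (stop x p _) (stop y q _) = cong T^ (proper-unique x y f p q)
  Runᶠ-deterministic {f} (stop x p a≤c) (next y q c<a _) with proper-unique x y f p q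
  ... | refl = contradiction c<a (ℤₚ.≤⇒≯ a≤c)
  Runᶠ-deterministic {f} (next x p c<a _) (stop y q a≤c) with proper-unique x y f p q
  ... | refl = contradiction c<a (ℤₚ.≤⇒≯ a≤c)
  Runᶠ-deterministic {f} (next x p _ r) (next y q _ s) with proper-unique x y f p q
  ... | refl = cong (λ w → T^ x ++ S ∷ w) (Runᶠ-deterministic r s)

  -- The invariant of irreducible products and how it passes from one exponent to the next.

  data SameSign (x b : ℤ) : Set where
    positive : 0ℤ < x → 0ℤ < b + b → SameSign x b
    negative : x < 0ℤ → 0ℤ < - (b + b) → SameSign x b

  -- The invariant of gram (∏ (x ∷ ys)) when no rule applies to ∏ (x ∷ ys).
  record Descending (x : ℤ) (f : Form ℤ) : Set where
    open Form f
    field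
      proper   : Properᶠ f
      0<c      : 0ℤ < c
      c<a      : 0ℤ < a - c
      sameSign : SameSign x b

  -- Polynomials in a natural number with natural coefficients are nonnegative by inspection. They
  -- are the certificates of the inequalities below, and `:quadratic` is their copy for the solver.
  quadratic : ℕ → ℕ → ℕ → ℕ → ℤ
  quadratic α β γ n = + α + + β * + n + + γ * (+ n * + n)

  :quadratic : ∀ {k} → ℕ → ℕ → ℕ → Polynomial k → Polynomial k
  :quadratic α β γ n = con (+ α) :+ con (+ β) :* n :+ con (+ γ) :* (n :* n)

  0≤ℕ : ∀ {n} → 0ℤ ≤ + n
  0≤ℕ = +≤+ ℕ.z≤n

  0≤quadratic : ∀ α β γ n → 0ℤ ≤ quadratic α β γ n
  0≤quadratic α β γ n =
    0≤+ (0≤+ (0≤ℕ {α}) (0≤* (0≤ℕ {β}) (0≤ℕ {n}))) (0≤* (0≤ℕ {γ}) (0≤* (0≤ℕ {n}) (0≤ℕ {n})))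

  0<quadratic : ∀ α β γ n → 0ℤ < quadratic (suc α) β γ n
  0<quadratic α β γ n =
    0<+ (0<+ (+<+ ℕ.z<s) (0≤* (0≤ℕ {β}) (0≤ℕ {n}))) (0≤* (0≤ℕ {γ}) (0≤* (0≤ℕ {n}) (0≤ℕ {n})))

  module Components {n} (y : Polynomial n) (f : Form (Polynomial n)) where
    open Form (P.flipᶠ (P.shear y f)) public

  -- The positive exponents begin at 3: at exponent 2 the entries are a = 6 and b = 3, and the
  -- strict bound 2b < a fails. The exponents 0, 1 and 2 at the right end are the redexes of R10,
  -- R11 and R12.
  descending-base⁺ : ∀ n → let y = + (3 ℕ.+ n) in Descending y (flipᶠ (shear y (gram [])))
  descending-base⁺ n = record
    { proper = record
      { -a≤2b = subst (0ℤ ≤_)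
          (solve 1 (λ n → let open F n in :quadratic 24 14 2 n := a :+ (b :+ b)) refl (+ n))
          (0≤quadratic 24 14 2 n)
      ; 2b<a = subst (0ℤ <_)
          (solve 1 (λ n → let open F n in :quadratic 4 6 2 n := a :- (b :+ b)) refl (+ n))
          (0<quadratic 3 6 2 n) }
    ; 0<c = +<+ ℕ.z<s
    ; c<a = subst (0ℤ <_)
        (solve 1 (λ n → let open F n in :quadratic 12 10 2 n := a :- c) refl (+ n))
        (0<quadratic 11 10 2 n)
    ; sameSign = positive (+<+ ℕ.z<s) (subst (0ℤ <_)
        (solve 1 (λ n → let open F n in :quadratic 10 4 0 n := b :+ b) refl (+ n))
        (0<quadratic 9 4 0 n))
    }
    where
    module F {k} (n : Polynomial k) =
      Components (con (+ 3) :+ n) (form (con (+ 2)) (con -1ℤ) (con (+ 2)))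

  -- Already exponent -1 is admissible: there a = 6 and b = -3, and the bound -a ≤ 2b is attained at
  -- the closed end of the interval. Hence the zero constant coefficient in its certificate.
  descending-base⁻ : ∀ n → let y = -[1+ n ] in Descending y (flipᶠ (shear y (gram [])))
  descending-base⁻ n = record
    { proper = record
      { -a≤2b = subst (0ℤ ≤_)
          (solve 1 (λ n → let open F n in :quadratic 0 2 2 n := a :+ (b :+ b)) refl (+ n))
          (0≤quadratic 0 2 2 n)
      ; 2b<a = subst (0ℤ <_)
          (solve 1 (λ n → let open F n in :quadratic 12 10 2 n := a :- (b :+ b)) refl (+ n))
          (0<quadratic 11 10 2 n) }
    ; 0<c = +<+ ℕ.z<s
    ; c<a = subst (0ℤ <_)
        (solve 1 (λ n → let open F n in :quadratic 4 6 2 n := a :- c) refl (+ n))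
        (0<quadratic 3 6 2 n)
    ; sameSign = negative -<+ (subst (0ℤ <_)
        (solve 1 (λ n → let open F n in :quadratic 6 4 0 n := :- (b :+ b)) refl (+ n))
        (0<quadratic 5 4 0 n))
    }
    where
    module F {k} (n : Polynomial k) =
      Components (:- (con (+ 1) :+ n)) (form (con (+ 2)) (con -1ℤ) (con (+ 2)))

  module _ {f x} (d : Descending x f) where
    open Form f
    open Descending d
    open Properᶠ proper

    private
      0<a : 0ℤ < a
      0<a = subst (0ℤ <_) (solve 2 (λ a c → c :+ (a :- c) := a) refl a c)
        (0<+ 0<c (ℤₚ.<⇒≤ c<a))

      -- The common shape of the certificates for one more exponent: v is a + 2b or a - 2b, which
      -- properness makes nonnegative, and u and w are polynomials in n.
      0<c+uv+wa : ∀ {u v w} → 0ℤ ≤ u → 0ℤ ≤ v → 0ℤ ≤ w → 0ℤ < c + u * v + w * a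
      0<c+uv+wa 0≤u 0≤v 0≤w = 0<+ (0<+ 0<c (0≤* 0≤u 0≤v)) (0≤* 0≤w (ℤₚ.<⇒≤ 0<a))

      module F⁺ {k} (a b c n : Polynomial k) =
        Components (con (+ 2) :+ n) (form a b c)
      module F⁻ {k} (a b c n : Polynomial k) =
        Components (:- (con (+ 2) :+ n)) (form a b c)

      0≤p = -a≤2b
      0≤q = ℤₚ.<⇒≤ 2b<a

    -- For the new form, a - 2b equals c + 2(y - 1)b + (y² - 2y)a in the old entries. The last term
    -- vanishes at y = 2, so this bound is left as a hypothesis; the others hold uniformly for y ≥
    -- 2.
    descending-step⁺ : ∀ n → let y = + (2 ℕ.+ n) ; g = flipᶠ (shear y f) in
      0ℤ < Form.a g - (Form.b g + Form.b g) → Descending y g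
    descending-step⁺ n 2b<a′ = record
      { proper = record
        { -a≤2b = ℤₚ.<⇒≤ (subst (0ℤ <_)
            (solve 4 (λ a b c n → let module F = F⁺ a b c n in
              c :+ :quadratic 3 1 0 n :* (a :+ (b :+ b)) :+ :quadratic 5 5 1 n :* a :=
              F.a :+ (F.b :+ F.b)) refl a b c (+ n))
            (0<c+uv+wa (0≤quadratic 3 1 0 n) 0≤p (0≤quadratic 5 5 1 n)))
        ; 2b<a = 2b<a′ }
      ; 0<c = 0<a
      ; c<a = subst (0ℤ <_)
          (solve 4 (λ a b c n → let module F = F⁺ a b c n in
              c :+ :quadratic 2 1 0 n :* (a :+ (b :+ b)) :+ :quadratic 1 3 1 n :* a :=
              F.a :- F.c) refl a b c (+ n))
          (0<c+uv+wa (0≤quadratic 2 1 0 n) 0≤p (0≤quadratic 1 3 1 n))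
      ; sameSign = positive (+<+ ℕ.z<s) (subst (0ℤ <_)
          (solve 4 (λ a b c n → let module F = F⁺ a b c n in
              a :+ :quadratic 2 2 0 n :* a :+ (a :+ (b :+ b)) := F.b :+ F.b) refl a b c (+ n))
          (0<+ (0<+ 0<a (0≤* (0≤quadratic 2 2 0 n) (ℤₚ.<⇒≤ 0<a))) 0≤p))
      }

    descending-step⁻ : ∀ n → let y = -[1+ suc n ] ; g = flipᶠ (shear y f) in
      0ℤ ≤ Form.a g + (Form.b g + Form.b g) → Descending y g
    descending-step⁻ n -a≤2b′ = record
      { proper = record
        { -a≤2b = -a≤2b′
        ; 2b<a = subst (0ℤ <_)
            (solve 4 (λ a b c n → let module F = F⁻ a b c n in
              c :+ :quadratic 3 1 0 n :* (a :- (b :+ b)) :+ :quadratic 5 5 1 n :* a :=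
              F.a :- (F.b :+ F.b)) refl a b c (+ n))
            (0<c+uv+wa (0≤quadratic 3 1 0 n) 0≤q (0≤quadratic 5 5 1 n)) }
      ; 0<c = 0<a
      ; c<a = subst (0ℤ <_)
          (solve 4 (λ a b c n → let module F = F⁻ a b c n in
              c :+ :quadratic 2 1 0 n :* (a :- (b :+ b)) :+ :quadratic 1 3 1 n :* a :=
              F.a :- F.c) refl a b c (+ n))
          (0<c+uv+wa (0≤quadratic 2 1 0 n) 0≤q (0≤quadratic 1 3 1 n))
      ; sameSign = negative -<+ (subst (0ℤ <_)
          (solve 4 (λ a b c n → let module F = F⁻ a b c n in
              a :+ :quadratic 2 2 0 n :* a :+ (a :- (b :+ b)) := :- (F.b :+ F.b)) refl a b c (+ n))
          (0<+ (0<+ 0<a (0≤* (0≤quadratic 2 2 0 n) (ℤₚ.<⇒≤ 0<a))) 0≤q))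
      }

    -- At exponent 2 the critical difference is c + 2b, so the sign of b, hence that of the previous
    -- exponent, settles it.
    descending-+2 : 0ℤ < b + b → Descending (+ 2) (flipᶠ (shear (+ 2) f))
    descending-+2 0<2b = descending-step⁺ 0 (subst (0ℤ <_)
      (solve 3 (λ a b c → let module F = F⁺ a b c (con 0ℤ) in
        c :+ (b :+ b) := F.a :- (F.b :+ F.b)) refl a b c)
      (0<+ 0<c (ℤₚ.<⇒≤ 0<2b)))

    descending-≥3 : ∀ n → let y = + (3 ℕ.+ n) in Descending y (flipᶠ (shear y f))
    descending-≥3 n = descending-step⁺ (suc n) (subst (0ℤ <_)
      (solve 4 (λ a b c n → let module F = F⁺ a b c (con 1ℤ :+ n) in
        c :+ :quadratic 2 1 0 n :* (a :+ (b :+ b)) :+ :quadratic 1 3 1 n :* a :=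
        F.a :- (F.b :+ F.b)) refl a b c (+ n))
      (0<c+uv+wa (0≤quadratic 2 1 0 n) 0≤p (0≤quadratic 1 3 1 n)))

    descending-−2 : 0ℤ < - (b + b) → Descending (- + 2) (flipᶠ (shear (- + 2) f))
    descending-−2 0<-2b = descending-step⁻ 0 (ℤₚ.<⇒≤ (subst (0ℤ <_)
      (solve 3 (λ a b c → let module F = F⁻ a b c (con 0ℤ) in
        c :+ :- (b :+ b) := F.a :+ (F.b :+ F.b)) refl a b c)
      (0<+ 0<c (ℤₚ.<⇒≤ 0<-2b))))

    descending-≤−3 : ∀ n → let y = -[1+ suc (suc n) ] in Descending y (flipᶠ (shear y f))
    descending-≤−3 n = descending-step⁻ (suc n) (ℤₚ.<⇒≤ (subst (0ℤ <_)
      (solve 4 (λ a b c n → let module F = F⁻ a b c (con 1ℤ :+ n) in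
        c :+ :quadratic 2 1 0 n :* (a :- (b :+ b)) :+ :quadratic 1 3 1 n :* a :=
        F.a :+ (F.b :+ F.b)) refl a b c (+ n))
      (0<c+uv+wa (0≤quadratic 2 1 0 n) 0≤q (0≤quadratic 1 3 1 n))))

  -- Irreducible words

  -- Applied to a word that begins with `T^ x`, the translation by x made by the algorithm removes
  -- that power.
  T^-cancel : ∀ x w → gram w ≡ shear (- x) (gram (T^ x ++ w))
  T^-cancel x w = begin
    gram w                              ≡⟨ shear-0 (gram w) ⟨
    shear 0ℤ (gram w)                   ≡⟨ cong (λ k → shear k (gram w)) (ℤₚ.+-inverseˡ x) ⟨
    shear (- x + x) (gram w)            ≡⟨ shear-+ (- x) x (gram w) ⟨
    shear (- x) (shear x (gram w))      ≡⟨ cong (shear (- x)) (gram-T^ x w) ⟨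
    shear (- x) (gram (T^ x ++ w))      ∎
    where open ≡-Reasoning

  run-stop : ∀ x → Runᶠ (gram (T^ x)) (T^ x)
  run-stop x = stop x
    -- The hexagonal form has a = c = 2 and 2b = -2: it is proper at the closed end of the interval,
    -- and the algorithm stops there because the order test is weak.
    (subst Properᶠ eq (record { -a≤2b = +≤+ ℕ.z≤n ; 2b<a = +<+ ℕ.z<s }))
    (subst (λ g → Form.a g ≤ Form.c g) eq ℤₚ.≤-refl)
    where
    eq : gram [] ≡ shear (- x) (gram (T^ x))
    eq = trans (T^-cancel x []) (cong (λ w → shear (- x) (gram w)) (++-identityʳ (T^ x)))

  -- Once `T^ x` is removed, the form is proper with c < a, so the algorithm swaps. Its flip cancels
  -- the one in `gram (S ∷ w)`, and the run on `gram w` takes over.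
  run-next : ∀ x {y} w → Descending y (gram (S ∷ w)) → Runᶠ (gram w) w →
             Runᶠ (gram (T^ x ++ S ∷ w)) (T^ x ++ S ∷ w)
  run-next x w d r = next x (subst Properᶠ eq proper)
    (subst (λ g → Form.c g < Form.a g) eq (0<j-i⇒i<j c<a))
    (subst (λ g → Runᶠ (flipᶠ g) w) eq r)
    where
    open Descending d
    eq : gram (S ∷ w) ≡ shear (- x) (gram (T^ x ++ S ∷ w))
    eq = T^-cancel x (S ∷ w)

  -- The condition on exponents in `TriviallyReduced`, rebuilt from the head of the list so that a
  -- product can be examined from left to right; `none` is the case of a bare power.
  data Inner≢0 : List ℤ → Set where
    none : Inner≢0 []
    last : ∀ x → Inner≢0 (x ∷ [])
    _∷_  : ∀ {x y ys} → x ≢ 0ℤ → Inner≢0 (y ∷ ys) → Inner≢0 (x ∷ y ∷ ys)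

  triviallyReduced : ∀ x {ys} → Inner≢0 ys → TriviallyReduced (T^ x ++ ∏ ys)
  triviallyReduced x none = subst TriviallyReduced (sym (++-identityʳ (T^ x))) (power x)
  triviallyReduced x {y ∷ ys} nz with split nz
    where
    split : ∀ {y ys} → Inner≢0 (y ∷ ys) → ∃ λ zs → ∃ λ z → All (_≢ 0ℤ) zs × zs ∷ʳ z ≡ y ∷ ys
    split (last x) = [] , x , [] , refl
    split (x≢0 ∷ nz) with split nz
    ... | zs , z , zs≢0 , eq = _ ∷ zs , z , x≢0 ∷ zs≢0 , cong (_ ∷_) eq
  ... | zs , z , zs≢0 , eq = subst (λ ys → TriviallyReduced (T^ x ++ ∏ ys)) eq (product x z zs≢0)

  Reducible : Word → Set
  Reducible w = ∃ λ w′ → w ⟶ w′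

  data TrivialForm : Word → Set where
    trivialForm : ∀ x {ys} → Inner≢0 ys → TrivialForm (T^ x ++ ∏ ys)

  -- The trivial rules alone: unlike ⟶, they are closed under prefixes.
  infix 4 _⟶ₜ_

  data _⟶ₜ_ : Word → Word → Set where
    R1  : ∀ ω ω′ → ω ++ S ∷ S ∷ ω′ ⟶ₜ ω ++ ω′
    R2  : ∀ ω x y ω′ → T^ x ++ T^ y ≢ T^ (x + y) →
          ω ++ T^ x ++ T^ y ++ ω′ ⟶ₜ ω ++ T^ (x + y) ++ ω′

  TriviallyReducible : Word → Set
  TriviallyReducible w = ∃ λ w′ → w ⟶ₜ w′

  ∷-reducible : ∀ l {w} → TriviallyReducible w → TriviallyReducible (l ∷ w)
  ∷-reducible l (_ , R1 ω ω′)         = _ , R1 (l ∷ ω) ω′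
  ∷-reducible l (_ , R2 ω x y ω′ neq) = _ , R2 (l ∷ ω) x y ω′ neq

  T++T⁻¹≢T^ : ∀ n → T^ 1ℤ ++ T^ -[1+ n ] ≢ T^ (1ℤ + -[1+ n ])
  T++T⁻¹≢T^ zero    ()
  T++T⁻¹≢T^ (suc n) ()

  T⁻¹++T≢T^ : ∀ n → T^ -1ℤ ++ T^ +[1+ n ] ≢ T^ (-1ℤ + +[1+ n ])
  T⁻¹++T≢T^ zero    ()
  T⁻¹++T≢T^ (suc n) ()

  trivial-progress : ∀ w → TriviallyReducible w ⊎ TrivialForm w
  trivial-progress [] = inj₂ (trivialForm 0ℤ none)
  trivial-progress (l ∷ w) with trivial-progress w
  ... | inj₁ r = inj₁ (∷-reducible l r)
  trivial-progress (S ∷ _)   | inj₂ (trivialForm x none) =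
    inj₂ (trivialForm 0ℤ (last x))
  trivial-progress (S ∷ _)   | inj₂ (trivialForm (+ zero) {_ ∷ _} nz)    = inj₁ (_ , R1 [] _)
  trivial-progress (S ∷ _)   | inj₂ (trivialForm +[1+ n ] {_ ∷ _} nz)    =
    inj₂ (trivialForm 0ℤ (_∷_ {x = +[1+ n ]} (λ ()) nz))
  trivial-progress (S ∷ _)   | inj₂ (trivialForm -[1+ n ] {_ ∷ _} nz)    =
    inj₂ (trivialForm 0ℤ (_∷_ {x = -[1+ n ]} (λ ()) nz))
  trivial-progress (T ∷ _)   | inj₂ (trivialForm (+ n) nz)               = inj₂ (trivialForm (+ suc n) nz)
  trivial-progress (T ∷ _)   | inj₂ (trivialForm -[1+ n ] nz)            = inj₁ (_ , R2 [] 1ℤ -[1+ n ] _ (T++T⁻¹≢T^ n))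
  trivial-progress (T⁻¹ ∷ _) | inj₂ (trivialForm (+ zero) nz)            = inj₂ (trivialForm -[1+ 0 ] nz)
  trivial-progress (T⁻¹ ∷ _) | inj₂ (trivialForm +[1+ n ] nz)            = inj₁ (_ , R2 [] -1ℤ +[1+ n ] _ (T⁻¹++T≢T^ n))
  trivial-progress (T⁻¹ ∷ _) | inj₂ (trivialForm -[1+ n ] nz)            = inj₂ (trivialForm -[1+ suc n ] nz)

  step : ∀ {u v} → u ⟶ₜ v → u ⟶ v
  step (R1 ω ω′)         = R1 ω ω′
  step (R2 ω x y ω′ neq) = R2 ω x y ω′ neq

  reducible-assoc : ∀ ω y zs → Reducible ((ω ++ S ∷ T^ y) ++ ∏ zs) → Reducible (ω ++ ∏ (y ∷ zs))
  reducible-assoc ω y zs = subst Reducible (++-assoc ω (S ∷ T^ y) (∏ zs))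

  -- The recursion goes to the right end, collecting the prefix in `ω` because the rules speak of
  -- the whole word, and builds the invariant on the way back. An exponent that would break the
  -- invariant is a redex. The run leaves out the leading S, which belongs to the swap made one
  -- level further out.
  ∏-progress : ∀ ω y ys → Inner≢0 (y ∷ ys) → TriviallyReduced (ω ++ ∏ (y ∷ ys)) →
    Reducible (ω ++ ∏ (y ∷ ys)) ⊎
    (Descending y (gram (∏ (y ∷ ys))) × Runᶠ (gram (T^ y ++ ∏ ys)) (T^ y ++ ∏ ys))
  ∏-progress ω (+ 0) [] _ tr = inj₁ (_ , R10 ω tr)
  ∏-progress ω (+ 1) [] _ tr = inj₁ (_ , R11 ω tr)
  ∏-progress ω (+ 2) [] _ tr = inj₁ (_ , R12 ω tr)
  ∏-progress ω y@(+ suc (suc (suc n))) [] _ tr = inj₂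
    ( subst (Descending y) (sym (gram-∏ y [])) (descending-base⁺ n)
    , subst (λ w → Runᶠ (gram w) w) (sym (++-identityʳ (T^ y))) (run-stop y))
  ∏-progress ω y@(-[1+ n ]) [] _ tr = inj₂
    ( subst (Descending y) (sym (gram-∏ y [])) (descending-base⁻ n)
    , subst (λ w → Runᶠ (gram w) w) (sym (++-identityʳ (T^ y))) (run-stop y))
  ∏-progress ω y (x ∷ ys) (y≢0 ∷ nz) tr
    with ∏-progress (ω ++ S ∷ T^ y) x ys nz
           (subst TriviallyReduced (sym (++-assoc ω (S ∷ T^ y) (∏ (x ∷ ys)))) tr)
  ... | inj₁ r       = inj₁ (reducible-assoc ω y (x ∷ ys) r)
  ... | inj₂ (d , r) = [ inj₁ , (λ d′ → inj₂ (subst (Descending y) (sym (gram-∏ y (x ∷ ys))) d′ , run-next y _ d r)) ]′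
    (head y y≢0 d (Descending.sameSign d) tr)
    where
    -- R5′ and R6′ ask for a nonzero second exponent. `Inner≢0` says nothing of the last one, but
    -- the strict signs of the invariant exclude zero.
    x≢0 : ∀ {b} → SameSign x b → x ≢ 0ℤ
    x≢0 (positive (+<+ ()) _) refl
    x≢0 (negative (+<+ ()) _) refl

    head : ∀ y → y ≢ 0ℤ → Descending x (gram (∏ (x ∷ ys))) → SameSign x (Form.b (gram (∏ (x ∷ ys)))) →
      TriviallyReduced (ω ++ ∏ (y ∷ x ∷ ys)) →
      Reducible (ω ++ ∏ (y ∷ x ∷ ys)) ⊎ Descending y (flipᶠ (shear y (gram (∏ (x ∷ ys)))))
    head (+ 0) y≢0 d s tr = contradiction refl y≢0
    head (+ 1) y≢0 d s tr = inj₁ (_ , R5′ ω x ys (x≢0 s) tr)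
    -- Exponent 2 preserves the invariant in front of a positive exponent and is a redex of R3 in
    -- front of a negative one; -2 behaves symmetrically with R4.
    head (+ 2) y≢0 d (positive _ 0<2b) tr = inj₂ (descending-+2 d 0<2b)
    head (+ 2) y≢0 d (negative x<0 _) tr = inj₁ (_ , R3 ω x ys x<0 tr)
    head (+ suc (suc (suc n))) y≢0 d s tr = inj₂ (descending-≥3 d n)
    head -[1+ 0 ] y≢0 d s tr = inj₁ (_ , R6′ ω x ys (x≢0 s) tr)
    head -[1+ 1 ] y≢0 d (positive 0<x _) tr = inj₁ (_ , R4 ω x ys 0<x tr)
    head -[1+ 1 ] y≢0 d (negative _ 0<-2b) tr = inj₂ (descending-−2 d 0<-2b)
    head -[1+ suc (suc n) ] y≢0 d s tr = inj₂ (descending-≤−3 d n)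

  progress : ∀ w → Reducible w ⊎ Runᶠ (gram w) w
  progress w with trivial-progress w
  ... | inj₁ (_ , r) = inj₁ (_ , step r)
  ... | inj₂ (trivialForm x {[]} _) =
    inj₂ (subst (λ w → Runᶠ (gram w) w) (sym (++-identityʳ (T^ x))) (run-stop x))
  ... | inj₂ (trivialForm x {y ∷ ys} nz) with ∏-progress (T^ x) y ys nz (triviallyReduced x nz)
  ...   | inj₁ r       = inj₁ r
  ...   | inj₂ (d , r) = inj₂ (run-next x _ d r)

  -- Normal forms of the rewriting and the words recorded by runs.

  gram-—↠ : ∀ {u v} → u —↠ v → gram u ≡ gram v
  gram-—↠ ε        = refl
  gram-—↠ (r ◅ rs) = trans (gram-⟶ r) (gram-—↠ rs)

  normalise : ∀ w → Acc (flip _⟶_) w → ∃ λ v → w —↠ v × Runᶠ (gram w) v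
  normalise w (acc rec) with progress w
  ... | inj₂ run     = w , ε , run
  ... | inj₁ (u , r) with normalise u (rec r)
  ...   | v , rs , run = v , r ◅ rs , subst (λ f → Runᶠ f v) (sym (gram-⟶ r)) run

  normal⇒run : ∀ {w} → IsNormalForm _⟶_ w → Runᶠ (gram w) w
  normal⇒run {w} nf with progress w
  ... | inj₁ r   = contradiction r nf
  ... | inj₂ run = run

  -- A cycle can be rotated so as to begin at its second word, whose accessibility proof is smaller.
  —↠-acyclic : ∀ {u v} → Acc (flip _⟶_) u → u ⟶ v → ¬ v —↠ u
  —↠-acyclic {v = v} (acc rec) r ε          = —↠-acyclic (rec r) r ε
  —↠-acyclic {v = v} (acc rec) r (r′ ◅ rs) = —↠-acyclic (rec r) r′ (rs ◅◅ (r ◅ ε))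

  -- A step from a run would lead back to it, as the rules preserve the Gram form
  -- and a form has only one run.
  run⇒normal : ∀ {w} → Runᶠ (gram w) w → IsNormalForm _⟶_ w
  run⇒normal {w} run (u , r) with normalise u (⟶-wellFounded u)
  ... | v , rs , run′ = —↠-acyclic (⟶-wellFounded w) r (subst (u —↠_) v≡w rs)
    where
    v≡w : v ≡ w
    v≡w = Runᶠ-deterministic (subst (λ f → Runᶠ f v) (sym (gram-⟶ r)) run′) run

  run⇒RewritesTo : ∀ {w v} → Runᶠ (gram w) v → RewritesTo w v
  run⇒RewritesTo {w} {v} run with normalise w (⟶-wellFounded w)
  ... | v′ , rs , run′ with Runᶠ-deterministic run run′
  ...   | refl = record
    { terminates = ⟶-wellFounded w
    ; reaches    = rs
    ; reduced    = run⇒normal (subst (λ f → Runᶠ f v) (gram-—↠ rs) run)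
    ; unique     = λ {u} rs′ nf →
        Runᶠ-deterministic (subst (λ f → Runᶠ f u) (sym (gram-—↠ rs′)) (normal⇒run nf)) run
    }

open IntegralForms

-- The integers inside the reals, and order without decidability.

module OrderedField {c ℓ₁ ℓ₂} (ℝ : RealField c ℓ₁ ℓ₂) where

  open RealField ℝ hiding (commutativeRing)
  open RealField ℝ using () renaming (commutativeRing to CR)
  open CommutativeRing CR using (ring; semiring; +-abelianGroup)
  open Algebra.Properties.Ring ring using (-‿distribˡ-*; -‿distribʳ-*; -‿involutive; -0#≈0#)
  open Algebra.Properties.AbelianGroup +-abelianGroup using (⁻¹-∙-comm)
  open Algebra.Properties.Semiring.Mult semiring using (×-homo-+; ×1-homo-*)

  open SetoidReasoning setoid

  fromℕ-+ : ∀ m n → fromℤ (+ (m ℕ.+ n)) ≈ fromℤ (+ m) + fromℤ (+ n)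
  fromℕ-+ m n = ×-homo-+ 1# m n

  fromℤ-neg : ∀ i → fromℤ (ℤ.- i) ≈ - fromℤ i
  fromℤ-neg (+ zero)  = sym -0#≈0#
  fromℤ-neg +[1+ n ]  = refl
  fromℤ-neg -[1+ n ]  = sym (-‿involutive _)

  fromℤ-⊖ : ∀ m n → fromℤ (m ℤ.⊖ n) ≈ fromℤ (+ m) - fromℤ (+ n)
  fromℤ-⊖ m zero = begin
    fromℤ (+ m)             ≈⟨ +-identityʳ _ ⟨
    fromℤ (+ m) + 0#        ≈⟨ +-congˡ -0#≈0# ⟨
    fromℤ (+ m) - 0#        ∎
  fromℤ-⊖ zero (suc n)      = sym (+-identityˡ _)
  fromℤ-⊖ (suc m) (suc n) = begin
    fromℤ (suc m ℤ.⊖ suc n)          ≡⟨ ≡.cong fromℤ (ℤₚ.[1+m]⊖[1+n]≡m⊖n m n) ⟩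
    fromℤ (m ℤ.⊖ n)                  ≈⟨ fromℤ-⊖ m n ⟩
    M - N                            ≈⟨ +-identityˡ _ ⟨
    -- The ring solver rests on this homomorphism, so the inserted 1 - 1 is distributed over the two
    -- terms by hand.
    0# + (M - N)                     ≈⟨ +-congʳ (-‿inverseʳ 1#) ⟨
    1# - 1# + (M - N)                ≈⟨ +-assoc _ _ _ ⟩
    1# + (- 1# + (M - N))            ≈⟨ +-congˡ (+-assoc _ _ _) ⟨
    1# + (- 1# + M - N)              ≈⟨ +-congˡ (+-congʳ (+-comm _ _)) ⟩
    1# + (M - 1# - N)                ≈⟨ +-congˡ (+-assoc _ _ _) ⟩
    1# + (M + (- 1# - N))            ≈⟨ +-assoc _ _ _ ⟨
    1# + M + (- 1# - N)              ≈⟨ +-congˡ (⁻¹-∙-comm 1# N) ⟩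
    1# + M - (1# + N)                ∎
    where
    M = fromℤ (+ m)
    N = fromℤ (+ n)

  fromℤ-+ : ∀ i j → fromℤ (i ℤ.+ j) ≈ fromℤ i + fromℤ j
  fromℤ-+ (+ m)    (+ n)    = fromℕ-+ m n
  fromℤ-+ (+ m)    -[1+ n ] = fromℤ-⊖ m (suc n)
  fromℤ-+ -[1+ m ] (+ n)    = trans (fromℤ-⊖ n (suc m)) (+-comm _ _)
  fromℤ-+ -[1+ m ] -[1+ n ] = begin
    - fromℤ (+ suc (suc (m ℕ.+ n)))             ≡⟨ ≡.cong (λ k → - fromℤ (+ suc k)) (ℕₚ.+-suc m n) ⟨
    - fromℤ (+ (suc m ℕ.+ suc n))               ≈⟨ -‿cong (fromℕ-+ (suc m) (suc n)) ⟩
    - (fromℤ (+ suc m) + fromℤ (+ suc n))       ≈⟨ ⁻¹-∙-comm _ _ ⟨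
    - fromℤ (+ suc m) - fromℤ (+ suc n)         ∎

  fromℤ-*⁺ : ∀ m j → fromℤ (+ m ℤ.* j) ≈ fromℤ (+ m) * fromℤ j
  fromℤ-*⁺ m (+ n) = begin
    fromℤ (+ m ℤ.* + n)   ≡⟨ ≡.cong fromℤ (ℤₚ.pos-* m n) ⟨
    fromℤ (+ (m ℕ.* n))   ≈⟨ ×1-homo-* m n ⟩
    fromℤ (+ m) * fromℤ (+ n) ∎
  fromℤ-*⁺ m -[1+ n ] = begin
    fromℤ (+ m ℤ.* -[1+ n ])         ≡⟨ ≡.cong fromℤ (ℤₚ.neg-distribʳ-* (+ m) +[1+ n ]) ⟨
    fromℤ (ℤ.- (+ m ℤ.* +[1+ n ]))   ≈⟨ fromℤ-neg (+ m ℤ.* +[1+ n ]) ⟩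
    - fromℤ (+ m ℤ.* +[1+ n ])       ≈⟨ -‿cong (fromℤ-*⁺ m +[1+ n ]) ⟩
    - (fromℤ (+ m) * fromℤ +[1+ n ]) ≈⟨ -‿distribʳ-* _ _ ⟩
    fromℤ (+ m) * - fromℤ +[1+ n ]   ∎

  fromℤ-* : ∀ i j → fromℤ (i ℤ.* j) ≈ fromℤ i * fromℤ j
  fromℤ-* (+ m)    j = fromℤ-*⁺ m j
  fromℤ-* -[1+ m ] j = begin
    fromℤ (-[1+ m ] ℤ.* j)         ≡⟨ ≡.cong fromℤ (ℤₚ.neg-distribˡ-* +[1+ m ] j) ⟨
    fromℤ (ℤ.- (+[1+ m ] ℤ.* j))   ≈⟨ fromℤ-neg (+[1+ m ] ℤ.* j) ⟩
    - fromℤ (+[1+ m ] ℤ.* j)       ≈⟨ -‿cong (fromℤ-*⁺ (suc m) j) ⟩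
    - (fromℤ +[1+ m ] * fromℤ j)   ≈⟨ -‿distribˡ-* _ _ ⟩
    - fromℤ +[1+ m ] * fromℤ j     ∎

  fromℤ-minus : ∀ i j → fromℤ (i ℤ.- j) ≈ fromℤ i - fromℤ j
  fromℤ-minus i j = trans (fromℤ-+ i (ℤ.- j)) (+-congˡ (fromℤ-neg j))

  fromℤ-1 : fromℤ 1ℤ ≈ 1#
  fromℤ-1 = +-identityʳ 1#

  private
    ACR : AlmostCommutativeRing c ℓ₁
    ACR = fromCommutativeRing CR

    fromℤ-morphism : ℤ.+-*-rawRing -Raw-AlmostCommutative⟶ ACR
    fromℤ-morphism = record
      { ⟦_⟧    = fromℤ
      ; +-homo = fromℤ-+
      ; *-homo = fromℤ-*
      ; -‿homo = fromℤ-neg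
      ; 0-homo = refl
      ; 1-homo = fromℤ-1
      }

    _≟_ : ∀ i j → Maybe (fromℤ i ≈ fromℤ j)
    i ≟ j with i ℤₚ.≟ j
    ... | yes eq = just (reflexive (≡.cong fromℤ eq))
    ... | no _   = nothing

  -- The coefficients are integers, whose equality is decidable; real equality is not assumed to be.
  module Solver = Algebra.Solver.Ring ℤ.+-*-rawRing ACR fromℤ-morphism _≟_

  open Solver using (solve; con; _:+_; _:*_; _:-_; :-_; _:=_)
  open IsStrictPartialOrder isStrictPartialOrder
    using (<-respʳ-≈; <-respˡ-≈)
    renaming (irrefl to <-irrefl; trans to <-trans; asym to <-asym)
  open Algebra.Apartness.Properties.HeytingCommutativeRing heytingCommutativeRing
    using (invertibleʳ⇒#; x-0≈x)

  <-resp-≈ : ∀ {x x′ y y′} → x ≈ x′ → y ≈ y′ → x < y → x′ < y′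
  <-resp-≈ x≈x′ y≈y′ x<y = <-respˡ-≈ x≈x′ (<-respʳ-≈ y≈y′ x<y)

  x<y⇒0<y-x : ∀ {x y} → x < y → 0# < y - x
  x<y⇒0<y-x {x} {y} x<y = <-respˡ-≈ (-‿inverseʳ x) (+-monoˡ-< (- x) x<y)

  0<y-x⇒x<y : ∀ {x y} → 0# < y - x → x < y
  0<y-x⇒x<y {x} {y} 0<y-x = <-resp-≈ (+-identityˡ x)
    (solve 2 (λ x y → y :- x :+ x := y) refl x y) (+-monoˡ-< x 0<y-x)

  x<0⇒0<-x : ∀ {x} → x < 0# → 0# < - x
  x<0⇒0<-x {x} x<0 = <-respʳ-≈ (+-identityˡ (- x)) (x<y⇒0<y-x x<0)

  0<-x⇒x<0 : ∀ {x} → 0# < - x → x < 0#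
  0<-x⇒x<0 {x} 0<-x = 0<y-x⇒x<y (<-respʳ-≈ (sym (+-identityˡ (- x))) 0<-x)

  0<x+y : ∀ {x y} → 0# < x → 0# < y → 0# < x + y
  0<x+y {x} {y} 0<x 0<y = <-trans 0<y (<-respˡ-≈ (+-identityˡ y) (+-monoˡ-< y 0<x))

  *-inverse : ∀ {x} (x#0 : x # 0#) → x * inverse x#0 ≈ 1#
  *-inverse {x} x#0 = trans (*-congʳ (sym (x-0≈x x))) (proj₂ (proj₂ (#⇒invertible x#0)))

  -- The inverse of x is y (xy)⁻¹. The sign of a real can be decided only once the real is known to
  -- be apart from zero, and this is how that is obtained below.
  *-#⇒#ˡ : ∀ {x y} → x * y # 0# → x # 0#
  *-#⇒#ˡ {x} {y} xy#0 = invertibleʳ⇒# (y * inverse xy#0 , (begin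
    (x - 0#) * (y * inverse xy#0)  ≈⟨ *-congʳ (x-0≈x x) ⟩
    x * (y * inverse xy#0)         ≈⟨ *-assoc _ _ _ ⟨
    x * y * inverse xy#0           ≈⟨ *-inverse xy#0 ⟩
    1#                             ∎))

  0<xk⇒0<x : ∀ {x k} → 0# < k → 0# < x * k → 0# < x
  0<xk⇒0<x {x} {k} 0<k 0<xk with #⇒<⊎> (*-#⇒#ˡ (#-sym (<⇒# 0<xk)))
  ... | inj₂ 0<x = 0<x
  ... | inj₁ x<0 = contradiction 0<xk (<-asym (0<-x⇒x<0
    (<-respʳ-≈ (sym (-‿distribˡ-* x k)) (*-pos (x<0⇒0<-x x<0) 0<k))))

  0≤x∧x#0⇒0<x : ∀ {x} → 0# ≤ x → x # 0# → 0# < x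
  0≤x∧x#0⇒0<x 0≤x x#0 with #⇒<⊎> x#0
  ... | inj₁ x<0 = contradiction x<0 0≤x
  ... | inj₂ 0<x = 0<x

  -- The hypothesis 0 ≤ y only denies y < 0 and allows no case distinction. Instead x + y is placed
  -- between 0 and x by cotransitivity of apartness, and each unwanted order would make y negative.
  0<x∧0≤y⇒0<x+y : ∀ {x y} → 0# < x → 0# ≤ y → 0# < x + y
  0<x∧0≤y⇒0<x+y {x} {y} 0<x 0≤y with #-cotrans (<⇒# 0<x) (x + y)
  ... | inj₁ 0#x+y with #⇒<⊎> 0#x+y
  ...   | inj₁ 0<x+y = 0<x+y
  ...   | inj₂ x+y<0 = contradiction
    (0<-x⇒x<0 (<-respʳ-≈ (solve 2 (λ x y → :- (x :+ y) :+ x := :- y) refl x y)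
      (0<x+y (x<0⇒0<-x x+y<0) 0<x)))
    0≤y
  0<x∧0≤y⇒0<x+y {x} {y} 0<x 0≤y | inj₂ x+y#x with #⇒<⊎> x+y#x
  ...   | inj₁ x+y<x = contradiction
    (0<-x⇒x<0 (<-respʳ-≈ (solve 2 (λ x y → x :- (x :+ y) := :- y) refl x y) (x<y⇒0<y-x x+y<x)))
    0≤y
  ...   | inj₂ x<x+y = <-trans 0<x x<x+y

  0≤x+y : ∀ {x y} → 0# ≤ x → 0# ≤ y → 0# ≤ x + y
  0≤x+y {x} {y} 0≤x 0≤y x+y<0 = 0≤x (0<-x⇒x<0 (<-respʳ-≈
    (solve 2 (λ x y → :- (x :+ y) :+ y := :- x) refl x y)
    (0<x∧0≤y⇒0<x+y (x<0⇒0<-x x+y<0) 0≤y)))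

  0≤x² : ∀ x → 0# ≤ x * x
  0≤x² x x²<0 with #⇒<⊎> (*-#⇒#ˡ (<⇒# x²<0))
  ... | inj₁ x<0 = <-asym x²<0 (<-respʳ-≈ (solve 1 (λ x → :- x :* :- x := x :* x) refl x)
                     (*-pos (x<0⇒0<-x x<0) (x<0⇒0<-x x<0)))
  ... | inj₂ 0<x = <-asym x²<0 (*-pos 0<x 0<x)

  x<y⇒x²<y² : ∀ {x y} → 0# ≤ x → x < y → x * x < y * y
  x<y⇒x²<y² {x} {y} 0≤x x<y = 0<y-x⇒x<y (<-respʳ-≈
    -- The factor y + x is written as (y - x) + 2x, a positive number plus a nonnegative one.
    (solve 2 (λ x y → (y :- x) :* ((y :- x) :+ (x :+ x)) := y :* y :- x :* x) refl x y)
    (*-pos 0<y-x (0<x∧0≤y⇒0<x+y 0<y-x (0≤x+y 0≤x 0≤x))))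
    where 0<y-x = x<y⇒0<y-x x<y

  √x<√y⇒x<y : ∀ {x y} → 0# ≤ x → 0# ≤ y → √ x < √ y → x < y
  √x<√y⇒x<y 0≤x 0≤y √x<√y =
    <-resp-≈ (√-square 0≤x) (√-square 0≤y) (x<y⇒x²<y² (√-nonneg 0≤x) √x<√y)

  -- Since y - x = (√y - √x)(√y + √x) is positive, √y - √x is apart from zero and has a sign. A
  -- negative sign would give y < x by squaring.
  x<y⇒√x<√y : ∀ {x y} → 0# ≤ x → 0# ≤ y → x < y → √ x < √ y
  x<y⇒√x<√y {x} {y} 0≤x 0≤y x<y = [ √y<√x⇒√x<√y , 0<y-x⇒x<y ]′ (#⇒<⊎> √y-√x#0)
    where
    √y-√x#0 : √ y - √ x # 0#
    √y-√x#0 = *-#⇒#ˡ (#-sym (<⇒# (<-respʳ-≈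
      (trans (+-cong (sym (√-square 0≤y)) (-‿cong (sym (√-square 0≤x))))
        (solve 2 (λ s t → t :* t :- s :* s := (t :- s) :* (t :+ s)) refl (√ x) (√ y)))
      (x<y⇒0<y-x x<y))))

    √y<√x⇒√x<√y : √ y - √ x < 0# → √ x < √ y
    √y<√x⇒√x<√y √y-√x<0 = contradiction x<y (<-asym (√x<√y⇒x<y 0≤y 0≤x
      (0<y-x⇒x<y (<-respʳ-≈ (solve 2 (λ s t → :- (t :- s) := s :- t) refl (√ x) (√ y))
        (x<0⇒0<-x √y-√x<0)))))

  0<fromℤ : ∀ {i} → 0ℤ ℤ.< i → 0# < fromℤ i
  0<fromℤ {+ zero}        (ℤ.+<+ ())
  0<fromℤ {+ suc zero}    _ = <-respʳ-≈ (sym fromℤ-1) 0<1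
  0<fromℤ {+ suc (suc n)} _ = 0<x+y 0<1 (0<fromℤ {+[1+ n ]} (ℤ.+<+ ℕ.z<s))

  module _ {h} (0<h : 0# < h) where

    0<i⇒0<ih : ∀ {i} → 0ℤ ℤ.< i → 0# < fromℤ i * h
    0<i⇒0<ih 0<i = *-pos (0<fromℤ 0<i) 0<h

    0<ih⇒0<i : ∀ {i} → 0# < fromℤ i * h → 0ℤ ℤ.< i
    0<ih⇒0<i {i} 0<ih with ℤₚ.<-cmp 0ℤ i
    ... | tri< 0<i _ _ = 0<i
    ... | tri≈ _ ≡.refl _ = contradiction 0<ih (<-irrefl (sym (zeroˡ h)))
    ... | tri> _ _ i<0 = contradiction 0<ih (<-asym (0<-x⇒x<0 (<-respʳ-≈
      (trans (*-congʳ (fromℤ-neg i)) (sym (-‿distribˡ-* (fromℤ i) h)))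
      (0<i⇒0<ih (ℤₚ.neg-mono-< i<0)))))

    [j-i]h : ∀ i j → fromℤ (j ℤ.- i) * h ≈ fromℤ j * h - fromℤ i * h
    [j-i]h i j = begin
      fromℤ (j ℤ.- i) * h           ≈⟨ *-congʳ (fromℤ-minus j i) ⟩
      (fromℤ j - fromℤ i) * h       ≈⟨ solve 3 (λ i j h → (j :- i) :* h := j :* h :- i :* h) refl _ _ h ⟩
      fromℤ j * h - fromℤ i * h     ∎

    i<j⇒ih<jh : ∀ {i j} → i ℤ.< j → fromℤ i * h < fromℤ j * h
    i<j⇒ih<jh {i} {j} i<j = 0<y-x⇒x<y (<-respʳ-≈ ([j-i]h i j)
      (0<i⇒0<ih (≡.subst (ℤ._< j ℤ.- i) (ℤₚ.+-inverseʳ i) (ℤₚ.+-monoˡ-< (ℤ.- i) i<j))))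

    ih<jh⇒i<j : ∀ {i j} → fromℤ i * h < fromℤ j * h → i ℤ.< j
    ih<jh⇒i<j {i} {j} ih<jh =
      0<j-i⇒i<j (0<ih⇒0<i (<-respʳ-≈ (sym ([j-i]h i j)) (x<y⇒0<y-x ih<jh)))

-- Gram matrices of real bases as multiples of integral forms.

module GramForm {c ℓ₁ ℓ₂} (ℝ : RealField c ℓ₁ ℓ₂) where

  open RealField ℝ
  open GaussianAlgorithm ℝ
  open OrderedField ℝ
  open Solver using (solve; con; _:+_; _:*_; _:-_; :-_; _:=_)
  open SetoidReasoning setoid

  infix 4 _≈ᵥ_ _≈ₚ_

  _≈ᵥ_ : ℝ² → ℝ² → Set ℓ₁
  (x , y) ≈ᵥ (x′ , y′) = x ≈ x′ × y ≈ y′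

  _≈ₚ_ : Pair → Pair → Set ℓ₁
  B ≈ₚ C = b₁ B ≈ᵥ b₁ C × b₂ B ≈ᵥ b₂ C

  ·-cong : ∀ {u u′ v v′} → u ≈ᵥ u′ → v ≈ᵥ v′ → u · v ≈ u′ · v′
  ·-cong (p , q) (r , s) = +-cong (*-cong p r) (*-cong q s)

  ·-comm : ∀ u v → u · v ≈ v · u
  ·-comm (x , y) (x′ , y′) = +-cong (*-comm x x′) (*-comm y y′)

  0≤v·v : ∀ v → 0# ≤ v · v
  0≤v·v (x , y) = 0≤x+y (0≤x² x) (0≤x² y)

  record HasGram (h : Carrier) (B : Pair) (f : Form ℤ) : Set ℓ₁ where
    module f = Form f
    field
      b₁·b₁ : b₁ B · b₁ B ≈ fromℤ f.a * h
      b₂·b₁ : b₂ B · b₁ B ≈ fromℤ f.b * h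
      b₂·b₂ : b₂ B · b₂ B ≈ fromℤ f.c * h

  module _ {h : Carrier} where

    -- The action of a matrix and the operations of the algorithm yield vectors that agree only up
    -- to `_≈_`.
    hasGram-resp : ∀ {B C f} → B ≈ₚ C → HasGram h C f → HasGram h B f
    hasGram-resp (p , q) g = record
      { b₁·b₁ = trans (·-cong p p) b₁·b₁
      ; b₂·b₁ = trans (·-cong q p) b₂·b₁
      ; b₂·b₂ = trans (·-cong q q) b₂·b₂
      }
      where open HasGram g

    hasGram-swap : ∀ {B f} → HasGram h B f → HasGram h (swap B) (flipᶠ f)
    hasGram-swap {B} g = record
      { b₁·b₁ = b₂·b₂
      ; b₂·b₁ = trans (·-comm (b₁ B) (b₂ B)) b₂·b₁
      ; b₂·b₂ = b₁·b₁
      }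
      where open HasGram g

    hasGram-translate : ∀ x {B f} → HasGram h B f → HasGram h (translate x B) (shear (ℤ.- x) f)
    hasGram-translate i {B@(pair (x , y) (z , w))} {form a b c} g = record
      { b₁·b₁ = b₁·b₁
      ; b₂·b₁ = begin
          (z - I * x) * x + (w - I * y) * y
            ≈⟨ solve 5 (λ i x y z w →
                 (z :- i :* x) :* x :+ (w :- i :* y) :* y :=
                 (z :* x :+ w :* y) :- i :* (x :* x :+ y :* y)) refl I x y z w ⟩
          (z * x + w * y) - I * (x * x + y * y)
            ≈⟨ +-cong b₂·b₁ (-‿cong (*-congˡ b₁·b₁)) ⟩
          fromℤ b * h - I * (fromℤ a * h)
            ≈⟨ solve 4 (λ i a b h → b :* h :- i :* (a :* h) := (b :+ :- i :* a) :* h) refl I _ _ h ⟩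
          (fromℤ b + - I * fromℤ a) * h
            ≈⟨ *-congʳ (+-congˡ (neg-* a)) ⟨
          (fromℤ b + fromℤ (ℤ.- i ℤ.* a)) * h
            ≈⟨ *-congʳ (fromℤ-+ b (ℤ.- i ℤ.* a)) ⟨
          fromℤ (b ℤ.+ ℤ.- i ℤ.* a) * h ∎
      ; b₂·b₂ = begin
          (z - I * x) * (z - I * x) + (w - I * y) * (w - I * y)
            ≈⟨ solve 5 (λ i x y z w →
                 (z :- i :* x) :* (z :- i :* x) :+ (w :- i :* y) :* (w :- i :* y) :=
                 (z :* z :+ w :* w) :+ :- i :* ((z :* x :+ w :* y) :+ (z :* x :+ w :* y))
                 :+ :- i :* (:- i :* (x :* x :+ y :* y))) refl I x y z w ⟩
          (z * z + w * w) + - I * ((z * x + w * y) + (z * x + w * y)) + - I * (- I * (x * x + y * y))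
            ≈⟨ +-cong (+-cong b₂·b₂ (*-congˡ (+-cong b₂·b₁ b₂·b₁))) (*-congˡ (*-congˡ b₁·b₁)) ⟩
          fromℤ c * h + - I * (fromℤ b * h + fromℤ b * h) + - I * (- I * (fromℤ a * h))
            ≈⟨ solve 5 (λ i a b c h →
                 c :* h :+ :- i :* (b :* h :+ b :* h) :+ :- i :* (:- i :* (a :* h)) :=
                 (c :+ :- i :* (b :+ b) :+ :- i :* (:- i :* a)) :* h) refl I _ _ _ h ⟩
          (fromℤ c + - I * (fromℤ b + fromℤ b) + - I * (- I * fromℤ a)) * h
            ≈⟨ *-congʳ fromℤ-c ⟨
          fromℤ (c ℤ.+ ℤ.- i ℤ.* (b ℤ.+ b) ℤ.+ ℤ.- i ℤ.* (ℤ.- i ℤ.* a)) * h ∎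
      }
      where
      open HasGram g
      I = fromℤ i

      neg-* : ∀ j → fromℤ (ℤ.- i ℤ.* j) ≈ - I * fromℤ j
      neg-* j = trans (fromℤ-* (ℤ.- i) j) (*-congʳ (fromℤ-neg i))

      fromℤ-c : fromℤ (c ℤ.+ ℤ.- i ℤ.* (b ℤ.+ b) ℤ.+ ℤ.- i ℤ.* (ℤ.- i ℤ.* a)) ≈
                fromℤ c + - I * (fromℤ b + fromℤ b) + - I * (- I * fromℤ a)
      fromℤ-c = trans (fromℤ-+ (c ℤ.+ ℤ.- i ℤ.* (b ℤ.+ b)) (ℤ.- i ℤ.* (ℤ.- i ℤ.* a))) (+-cong
        (trans (fromℤ-+ c (ℤ.- i ℤ.* (b ℤ.+ b)))
          (+-congˡ (trans (neg-* (b ℤ.+ b)) (*-congˡ (fromℤ-+ b b)))))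
        (trans (neg-* (ℤ.- i ℤ.* a)) (*-congˡ (neg-* a))))

    value-hasGram : ∀ {R} → HasGram h R (gram []) → ∀ w → HasGram h (value w ∙ R) (gram w)
    value-hasGram {pair (x , y) (z , w)} g [] =
      hasGram-resp ((l x z , l y w) , (r x z , r y w)) g
      where
      l : ∀ x y → fromℤ 1ℤ * x + fromℤ 0ℤ * y ≈ x
      l = solve 2 (λ x y → con 1ℤ :* x :+ con 0ℤ :* y := x) refl
      r : ∀ x y → fromℤ 0ℤ * x + fromℤ 1ℤ * y ≈ y
      r = solve 2 (λ x y → con 0ℤ :* x :+ con 1ℤ :* y := y) refl
    value-hasGram {R} g (S ∷ w) with value w | value-hasGram g w
    ... | mat a b c d | g′ = ≡.subst (λ M → HasGram h (M ∙ R) _) (≡.sym (S-⊗ a b c d)) (hasGram-swap g′)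
    value-hasGram {R@(pair (x , y) (z , w))} g (T ∷ u) with value u | value-hasGram g u
    ... | mat a b c d | g′ = ≡.subst (λ M → HasGram h (M ∙ R) _) (≡.sym (T-⊗ a b c d))
      -- T adds the first row to the second, which is a translation by -1, since `translate`
      -- subtracts.
      (hasGram-resp ((refl , refl) , (row x z , row y w)) (hasGram-translate -1ℤ g′))
      where
      row : ∀ x y → fromℤ (c ℤ.+ a) * x + fromℤ (d ℤ.+ b) * y ≈
            fromℤ c * x + fromℤ d * y - fromℤ -1ℤ * (fromℤ a * x + fromℤ b * y)
      row x y = trans (+-cong (*-congʳ (fromℤ-+ c a)) (*-congʳ (fromℤ-+ d b)))
        (solve 6 (λ a b c d x y → (c :+ a) :* x :+ (d :+ b) :* y :=
          c :* x :+ d :* y :- con -1ℤ :* (a :* x :+ b :* y)) refl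
          (fromℤ a) (fromℤ b) (fromℤ c) (fromℤ d) x y)
    value-hasGram {R@(pair (x , y) (z , w))} g (T⁻¹ ∷ u) with value u | value-hasGram g u
    ... | mat a b c d | g′ = ≡.subst (λ M → HasGram h (M ∙ R) _) (≡.sym (T⁻¹-⊗ a b c d))
      (hasGram-resp ((refl , refl) , (row x z , row y w)) (hasGram-translate 1ℤ g′))
      where
      row : ∀ x y → fromℤ (c ℤ.- a) * x + fromℤ (d ℤ.- b) * y ≈
            fromℤ c * x + fromℤ d * y - fromℤ 1ℤ * (fromℤ a * x + fromℤ b * y)
      row x y = trans (+-cong (*-congʳ (fromℤ-minus c a)) (*-congʳ (fromℤ-minus d b)))
        (solve 6 (λ a b c d x y → (c :- a) :* x :+ (d :- b) :* y :=
          c :* x :+ d :* y :- con 1ℤ :* (a :* x :+ b :* y)) refl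
          (fromℤ a) (fromℤ b) (fromℤ c) (fromℤ d) x y)

-- Runs on real bases and runs on their forms.

module Correspondence {c ℓ₁ ℓ₂} (ℝ : RealField c ℓ₁ ℓ₂) where

  open RealField ℝ
  open GaussianAlgorithm ℝ
  open OrderedField ℝ
  open GramForm ℝ
  open Solver using (solve; con; _:+_; _:*_; _:-_; :-_; _:=_)
  open SetoidReasoning setoid hiding (stop)
  open IsStrictPartialOrder isStrictPartialOrder
    using (<-respʳ-≈)

  ½+½ : ½ + ½ ≈ 1#
  ½+½ = trans (sym (trans (distribʳ ½ 1# 1#) (+-cong (*-identityˡ ½) (*-identityˡ ½)))) (*-inverse _)

  m-* : ∀ B (b₁b₁#0 : b₁ B · b₁ B # 0#) → m B b₁b₁#0 * (b₁ B · b₁ B) ≈ b₂ B · b₁ B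
  m-* B b₁b₁#0 = begin
    p * k⁻¹ * k    ≈⟨ *-assoc p k⁻¹ k ⟩
    p * (k⁻¹ * k)  ≈⟨ *-congˡ (trans (*-comm k⁻¹ k) (*-inverse b₁b₁#0)) ⟩
    p * 1#         ≈⟨ *-identityʳ p ⟩
    p              ∎
    where
    p = b₂ B · b₁ B
    k = b₁ B · b₁ B
    k⁻¹ = inverse b₁b₁#0

  module _ {h} (0<h : 0# < h) {B f} (g : HasGram h B f) where
    open HasGram g

    private
      k = b₁ B · b₁ B

    ∣b₂∣<∣b₁∣⇒c<a : ∣ b₂ B ∣ < ∣ b₁ B ∣ → f.c ℤ.< f.a
    ∣b₂∣<∣b₁∣⇒c<a lt = ih<jh⇒i<j 0<h
      (<-resp-≈ b₂·b₂ b₁·b₁ (√x<√y⇒x<y (0≤v·v (b₂ B)) (0≤v·v (b₁ B)) lt))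

    c<a⇒∣b₂∣<∣b₁∣ : f.c ℤ.< f.a → ∣ b₂ B ∣ < ∣ b₁ B ∣
    c<a⇒∣b₂∣<∣b₁∣ c<a = x<y⇒√x<√y (0≤v·v (b₂ B)) (0≤v·v (b₁ B))
      (<-resp-≈ (sym b₂·b₂) (sym b₁·b₁) (i<j⇒ih<jh 0<h c<a))

    module _ (k#0 : k # 0#) where

      private
        0<k+k : 0# < k + k
        0<k+k = 0<x+y 0<k 0<k
          where 0<k = 0≤x∧x#0⇒0<x (0≤v·v (b₁ B)) k#0

        M = m B k#0

      -- The factor 2k clears both the denominator of m and the halves, so that s = ½ and s = -½
      -- leave integer multiples of h, whose signs are decided in the integers.
      scaled : ∀ s → (s - M) * (k + k) ≈ (s + s) * k - (fromℤ f.b * h + fromℤ f.b * h)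
      scaled s = begin
        (s - M) * (k + k)               ≈⟨ solve 3 (λ s m k → (s :- m) :* (k :+ k) :=
                                             (s :+ s) :* k :- (m :* k :+ m :* k)) refl s M k ⟩
        (s + s) * k - (M * k + M * k)   ≈⟨ +-congˡ (-‿cong (+-cong Mk Mk)) ⟩
        (s + s) * k - (fromℤ f.b * h + fromℤ f.b * h) ∎
        where
        Mk : M * k ≈ fromℤ f.b * h
        Mk = trans (m-* B k#0) b₂·b₁

      ½-m : (½ - M) * (k + k) ≈ fromℤ (f.a ℤ.- (f.b ℤ.+ f.b)) * h
      ½-m = begin
        (½ - M) * (k + k)                    ≈⟨ scaled ½ ⟩
        (½ + ½) * k - (b′ * h + b′ * h)      ≈⟨ +-congʳ (*-cong ½+½ b₁·b₁) ⟩
        1# * (a′ * h) - (b′ * h + b′ * h)    ≈⟨ +-cong (*-identityˡ _) (-‿cong (sym (distribʳ h b′ b′))) ⟩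
        a′ * h - (b′ + b′) * h               ≈⟨ +-congˡ (-‿cong (*-congʳ (fromℤ-+ f.b f.b))) ⟨
        a′ * h - fromℤ (f.b ℤ.+ f.b) * h     ≈⟨ [j-i]h 0<h (f.b ℤ.+ f.b) f.a ⟨
        fromℤ (f.a ℤ.- (f.b ℤ.+ f.b)) * h    ∎
        where
        a′ = fromℤ f.a
        b′ = fromℤ f.b

      -½-m : (- ½ - M) * (k + k) ≈ fromℤ (ℤ.- (f.a ℤ.+ (f.b ℤ.+ f.b))) * h
      -½-m = begin
        (- ½ - M) * (k + k)                      ≈⟨ scaled (- ½) ⟩
        (- ½ - ½) * k - (b′ * h + b′ * h)        ≈⟨ solve 4 (λ s k b h →
                                                      (:- s :- s) :* k :- (b :* h :+ b :* h) :=
                                                      :- ((s :+ s) :* k :+ (b :+ b) :* h)) refl ½ k b′ h ⟩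
        - ((½ + ½) * k + (b′ + b′) * h)          ≈⟨ -‿cong (+-congʳ (*-cong ½+½ b₁·b₁)) ⟩
        - (1# * (a′ * h) + (b′ + b′) * h)        ≈⟨ -‿cong (+-congʳ (*-identityˡ _)) ⟩
        - (a′ * h + (b′ + b′) * h)               ≈⟨ solve 3 (λ a b h → :- (a :* h :+ b :* h) :=
                                                      :- (a :+ b) :* h) refl a′ (b′ + b′) h ⟩
        - (a′ + (b′ + b′)) * h                   ≈⟨ *-congʳ (-‿cong (+-congˡ (fromℤ-+ f.b f.b))) ⟨
        - (a′ + fromℤ (f.b ℤ.+ f.b)) * h         ≈⟨ *-congʳ (-‿cong (fromℤ-+ f.a (f.b ℤ.+ f.b))) ⟨
        - fromℤ (f.a ℤ.+ (f.b ℤ.+ f.b)) * h      ≈⟨ *-congʳ (fromℤ-neg (f.a ℤ.+ (f.b ℤ.+ f.b))) ⟨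
        fromℤ (ℤ.- (f.a ℤ.+ (f.b ℤ.+ f.b))) * h  ∎
        where
        a′ = fromℤ f.a
        b′ = fromℤ f.b

      m<s⇒0<i : ∀ {s i} → (s - M) * (k + k) ≈ fromℤ i * h → M < s → 0ℤ ℤ.< i
      m<s⇒0<i eq m<s = 0<ih⇒0<i 0<h (<-respʳ-≈ eq (*-pos (x<y⇒0<y-x m<s) 0<k+k))

      0<i⇒m<s : ∀ {s i} → (s - M) * (k + k) ≈ fromℤ i * h → 0ℤ ℤ.< i → M < s
      0<i⇒m<s eq 0<i = 0<y-x⇒x<y (0<xk⇒0<x 0<k+k (<-respʳ-≈ (sym eq) (0<i⇒0<ih 0<h 0<i)))

    proper⇒properᶠ : Proper B → Properᶠ f
    proper⇒properᶠ p = record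
      { -a≤2b = ℤₚ.≮⇒≥ λ neg → -½≤m (0<i⇒m<s b₁·b₁#0 (-½-m b₁·b₁#0) (ℤₚ.neg-mono-< neg))
      ; 2b<a  = m<s⇒0<i b₁·b₁#0 (½-m b₁·b₁#0) m<½
      }
      where open Proper p

    properᶠ⇒proper : Properᶠ f → Proper B
    properᶠ⇒proper p = record
      { b₁·b₁#0 = k#0
      ; -½≤m    = λ m<-½ → ℤₚ.≤⇒≯ -a≤2b (≡.subst (ℤ._< 0ℤ) (ℤₚ.neg-involutive _)
                    (ℤₚ.neg-mono-< (m<s⇒0<i k#0 (-½-m k#0) m<-½)))
      ; m<½     = 0<i⇒m<s k#0 (½-m k#0) 2b<a
      }
      where
      open Properᶠ p
      k#0 : k # 0#
      k#0 = #-sym (<⇒# (<-respʳ-≈ (sym b₁·b₁) (0<i⇒0<ih 0<h (proper⇒0<a f p))))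

  -- The strict test of a swap carries over directly. The weak test of a stop is the negation of a
  -- strict one, so it carries over by the opposite implication.
  run⇒runᶠ : ∀ {h} → 0# < h → ∀ {B f w R} → HasGram h B f → Run B w R → Runᶠ f w
  run⇒runᶠ 0<h g (stop x p b₁≤b₂) = stop x (proper⇒properᶠ 0<h g′ p)
    (ℤₚ.≮⇒≥ (b₁≤b₂ ∘ c<a⇒∣b₂∣<∣b₁∣ 0<h g′))
    where g′ = hasGram-translate x g
  run⇒runᶠ 0<h g (next x p b₂<b₁ r) = next x (proper⇒properᶠ 0<h g′ p)
    (∣b₂∣<∣b₁∣⇒c<a 0<h g′ b₂<b₁) (run⇒runᶠ 0<h (hasGram-swap g′) r)
    where g′ = hasGram-translate x g

  runᶠ⇒run : ∀ {h} → 0# < h → ∀ {B f w} → HasGram h B f → Runᶠ f w → ∃ (Run B w)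
  runᶠ⇒run 0<h g (stop x p a≤c) = _ , stop x (properᶠ⇒proper 0<h g′ p)
    (ℤₚ.≤⇒≯ a≤c ∘ ∣b₂∣<∣b₁∣⇒c<a 0<h g′)
    where g′ = hasGram-translate x g
  runᶠ⇒run 0<h g (next x p c<a r) with runᶠ⇒run 0<h (hasGram-swap (hasGram-translate x g)) r
  ... | R , r′ = R , next x (properᶠ⇒proper 0<h g′ p) (c<a⇒∣b₂∣<∣b₁∣ 0<h g′ c<a) r′
    where g′ = hasGram-translate x g

  module _ (R : Pair) (reduced : Reduced R) (∣b₁∣≈∣b₂∣ : ∣ b₁ R ∣ ≈ ∣ b₂ R ∣)
           (m≈-½ : m R (Reduced.b₁·b₁#0 reduced) ≈ - ½) where

    private
      k = b₁ R · b₁ R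
      h = ½ * k

    0<½b₁² : 0# < ½ * (b₁ R · b₁ R)
    0<½b₁² = *-pos 0<½ (0≤x∧x#0⇒0<x (0≤v·v (b₁ R)) (Reduced.b₁·b₁#0 reduced))
      where
      0<½ : 0# < ½
      0<½ = 0<xk⇒0<x 0<1+1 (<-respʳ-≈
        (sym (trans (distribˡ ½ 1# 1#) (trans (+-cong (*-identityʳ ½) (*-identityʳ ½)) ½+½))) 0<1)

    -- The unit is half of k so that m = -½ becomes an integral entry: b₂·b₁ = -k/2 is -1 times the
    -- unit, and both squared norms are k, twice the unit.
    hexagonal : HasGram (½ * (b₁ R · b₁ R)) R (gram [])
    hexagonal = record
      { b₁·b₁ = k≈2h
      ; b₂·b₁ = begin
          b₂ R · b₁ R    ≈⟨ m-* R (Reduced.b₁·b₁#0 reduced) ⟨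
          m R _ * k      ≈⟨ *-congʳ m≈-½ ⟩
          - ½ * k        ≈⟨ solve 2 (λ s k → :- s :* k := con -1ℤ :* (s :* k)) refl ½ k ⟩
          fromℤ -1ℤ * h  ∎
      ; b₂·b₂ = begin
          b₂ R · b₂ R          ≈⟨ √-square (0≤v·v (b₂ R)) ⟨
          ∣ b₂ R ∣ * ∣ b₂ R ∣  ≈⟨ *-cong ∣b₁∣≈∣b₂∣ ∣b₁∣≈∣b₂∣ ⟨
          ∣ b₁ R ∣ * ∣ b₁ R ∣  ≈⟨ √-square (0≤v·v (b₁ R)) ⟩
          k                    ≈⟨ k≈2h ⟩
          fromℤ (+ 2) * h      ∎
      }
      where
      k≈2h : k ≈ fromℤ (+ 2) * h
      k≈2h = begin
        k                ≈⟨ *-identityˡ k ⟨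
        1# * k           ≈⟨ *-congʳ ½+½ ⟨
        (½ + ½) * k      ≈⟨ solve 2 (λ s k → (s :+ s) :* k := con (+ 2) :* (s :* k)) refl ½ k ⟩
        fromℤ (+ 2) * h  ∎

theorem4 : ∀ {c ℓ₁ ℓ₂} (ℝ : RealField c ℓ₁ ℓ₂) →
    let open RealField ℝ
        open GaussianAlgorithm ℝ
    in (R : Pair) → IsLatticeBasis R →
       (reduced : Reduced R) →
       ∣ b₁ R ∣ ≈ ∣ b₂ R ∣ →
       m R (Reduced.b₁·b₁#0 reduced) ≈ - ½ →
       (U : Mat₂) → IsGL₂ U →
       (ω₁ : Word) → value ω₁ ≡ U →
       Σ (∃! _≡_ (IsGaussianDecomposition R U)) λ (ω , _) → RewritesTo ω₁ ω
theorem4 ℝ R _ reduced ∣b₁∣≈∣b₂∣ m≈-½ _ _ ω₁ ≡.refl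
  with normalise ω₁ (⟶-wellFounded ω₁)
... | ω , _ , run =
  -- The normal form of `ω₁` supplies a run on its form, which is realised on the real basis. Any
  -- run on that basis projects to a run on the same form, hence records the same word.
  (ω , runᶠ⇒run 0<h g run , λ (_ , run′) → Runᶠ-deterministic run (run⇒runᶠ 0<h g run′)) ,
  run⇒RewritesTo run
  where
  open Correspondence ℝ
  open GramForm ℝ using (value-hasGram)
  0<h = 0<½b₁² R reduced ∣b₁∣≈∣b₂∣ m≈-½
  g   = value-hasGram (hexagonal R reduced ∣b₁∣≈∣b₂∣ m≈-½) ω₁
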